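{- Let $m\geqslant 2$ be an integer, let $G$ be a group with $|G|\geqslant 2$ (finite or infinite), and let $\mathcal{D}(G,m)$ be the diagonal semilattice, with rank function $\rho$, bottom element $E$ and top element $U$ (so that $\rho(U)=m$). Then the Möbius function $\mu$ of $\mathcal{D}(G,m)$ is given by \[ \mu(S,T)=\begin{cases}(-1)^{\rho(T)-\rho(S)} & \text{if } T\neq U,\\ (-1)^{\rho(U)-\rho(S)}\,(\rho(U)-\rho(S)) = (-1)^{m-\rho(S)}\,(m-\rho(S)) & \text{if } T=U,\end{cases} \] for all $S,T\in\mathcal{D}(G,m)$ with $S\preccurlyeq T$.
   Context: Partitions of a set $\Omega$ are ordered by refinement: $P\preccurlyeq Q$ means that every part of $P$ is contained in a part of $Q$. $E$ is the partition of $\Omega$ into singletons and $U$ is the partition with a single part. $P\vee Q$ is the least upper bound of $P$ and $Q$ in this order: its parts are the connected components of the graph on $\Omega$ in which two distinct points are joined if they lie in the same part of $P$ or the same part of $Q$. Diagonal semilattice: let $\Omega=G^m$. For $1\leqslant i\leqslant m$, let $Q_i$ be the partition of $\Omega$ in which $(g_1,\ldots,g_m)$ and $(h_1,\ldots,h_m)$ are in the same part if and only if $g_j=h_j$ for all $j\neq i$. Let $Q_0$ be the partition in which $(g_1,\ldots,g_m)$ and $(h_1,\ldots,h_m)$ are in the same part if and only if there is $x\in G$ with $h_i=xg_i$ for all $i$. The diagonal semilattice $\mathcal{D}(G,m)$ is the set of all partitions $\bigvee_{i\in I}Q_i$ for $I\subseteq\{0,1,\ldots,m\}$ (the empty supremum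 being $E$), ordered by $\preccurlyeq$; it contains $E$ and $U$. The rank $\rho(S)$ of $S\in\mathcal{D}(G,m)$ is the number of steps in a maximal chain from $E$ to $S$ in $\mathcal{D}(G,m)$. The zeta function of a finite partially ordered set $\mathcal{S}$ is the $\mathcal{S}\times\mathcal{S}$ matrix with $\zeta(P,Q)=1$ if $P\preccurlyeq Q$ and $\zeta(P,Q)=0$ otherwise; the Möbius function $\mu$ is the inverse matrix of $\zeta$.
   Formalization: For S = T = U the stated formula gives 0, whereas μ(U,U) = 1 in every poset; the case T = U is therefore proved for S ≠ U, and μ(U,U) = 1 is stated separately. -}

module Defs where

open import Algebra.Bundles using (Group)
open import Data.Fin.Base as Fin using (Fin; zero; suc; fromℕ)
open import Data.Fin.Properties using (_≟_)
open import Data.Fin.Subset using (Subset; _∈_; ⊤; ⊥)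
open import Data.Fin.Subset.Properties using (∈⊤; ∉⊥)
open import Data.Bool.Base using (if_then_else_)
open import Data.Integer.Base using (ℤ; 0ℤ; 1ℤ; _+_; _*_)
open import Data.List.Base using (List; []; _∷_; foldr; map; allFin)
import Data.List.Membership.Propositional as List
open import Data.List.Membership.Propositional.Properties using (∈-allFin)
open import Data.List.Relation.Unary.Any using (here; there)
import Data.List.Relation.Unary.Enumerates.Setoid as Enumerates
import Data.List.Relation.Unary.Unique.Setoid as UniqueSetoid
open import Data.Nat.Base using (ℕ; suc)
open import Data.Product.Base using (Σ-syntax; ∃-syntax; ∃₂; _×_; _,_; proj₁)
open import Data.Sum.Base using (_⊎_; inj₁; inj₂)
import Data.Unit.Polymorphic.Base as Unit
open import Data.Vec.Functional using (Vector; updateAt)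
open import Data.Vec.Functional.Properties using (updateAt-updates; updateAt-minimal)
import Data.Vec.Functional.Relation.Binary.Equality.Setoid as VecEq
open import Function.Base using (const)
open import Level using (Level; _⊔_; Lift; lift; lower) renaming (suc to lsuc)
open import Relation.Binary.Bundles using (Setoid; Poset)
open import Relation.Binary.Core using (Rel; _⇒_)
open import Relation.Binary.Definitions using (Decidable)
open import Relation.Binary.Structures using (IsEquivalence)
open import Relation.Binary.PropositionalEquality.Core as ≡ using (_≡_; _≢_)
open import Relation.Nullary.Decidable.Core using (Dec; does; yes; no)
open import Relation.Nullary.Negation.Core using (¬_; contradiction)
import Relation.Binary.Construct.Closure.Equivalence as EqC
import Relation.Binary.Construct.Interior.Symmetric as Interior
import Relation.Binary.Construct.On as On
import Relation.Binary.Properties.Poset as PosetProperties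

------------------------------------------------------------------------
-- Partitions

-- A partition of a setoid is represented by the relation "x and y lie in
-- the same part", which must not separate elements that are equal.

record Partition {a ℓ} (S : Setoid a ℓ) : Set (lsuc (a ⊔ ℓ)) where
  open Setoid S using (Carrier; _≈_)
  field
    _∼_           : Rel Carrier (a ⊔ ℓ)
    isEquivalence : IsEquivalence _∼_
    ≈⇒∼           : _≈_ ⇒ _∼_

module Partitions {a ℓ} (S : Setoid a ℓ) where

  open Setoid S using (Carrier; _≈_) renaming (isEquivalence to ≈-isEquivalence)
  open Partition

  -- "The part of P containing x is contained in the part of Q containing x",
  -- for every x.

  infix 4 _≼_

  _≼_ : Rel (Partition S) (a ⊔ ℓ)
  P ≼ Q = P ._∼_ ⇒ Q ._∼_

  -- Two partitions are equal when each refines the other.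

  poset : Poset (lsuc (a ⊔ ℓ)) (a ⊔ ℓ) (a ⊔ ℓ)
  poset = Interior.poset {R = _≼_} (λ p → p) (λ f g p → g (f p))

  E : Partition S
  E = record
    { _∼_           = λ x y → Lift (a ⊔ ℓ) (x ≈ y)
    ; isEquivalence = record
      { refl  = lift refl
      ; sym   = λ p → lift (sym (lower p))
      ; trans = λ p q → lift (trans (lower p) (lower q))
      }
    ; ≈⇒∼           = lift
    }
    where open IsEquivalence ≈-isEquivalence

  U : Partition S
  U = record
    { _∼_           = λ _ _ → Unit.⊤
    ; isEquivalence = record
      { refl = Unit.tt ; sym = λ _ → Unit.tt ; trans = λ _ _ → Unit.tt }
    ; ≈⇒∼           = λ _ → Unit.tt
    }

  -- The supremum of the Q i with i ∈ I: its parts are the connected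
  -- components of the graph joining points that lie in the same part of some
  -- such Q i.  Equal points are joined as well, so that the closure respects
  -- the equality of S even when I is empty.

  module _ {n} (I : Subset n) (Q : Fin n → Partition S) where

    Joined : Rel Carrier (a ⊔ ℓ)
    Joined x y = x ≈ y ⊎ (∃[ i ] i ∈ I × Q i ._∼_ x y)

    ⋁ : Partition S
    ⋁ = record
      { _∼_           = EqC.EqClosure Joined
      ; isEquivalence = EqC.isEquivalence Joined
      ; ≈⇒∼           = λ p → EqC.return (inj₁ p)
      }

    ⋁-upper : ∀ {i} → i ∈ I → Q i ≼ ⋁
    ⋁-upper i∈I p = EqC.return (inj₂ (_ , i∈I , p))

    ⋁-least : ∀ {P} → (∀ {i} → i ∈ I → Q i ≼ P) → ⋁ ≼ P
    ⋁-least {P} Q≼P = EqC.fold (P .isEquivalence) λ where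
      (inj₁ p)             → P .≈⇒∼ p
      (inj₂ (i , i∈I , p)) → Q≼P i∈I p

------------------------------------------------------------------------
-- Rank and Möbius function of a poset

module _ {a ℓ₁ ℓ₂} (P : Poset a ℓ₁ ℓ₂) where

  open Poset P
  open PosetProperties P using (_<_)

  -- A maximal chain from x to y with n steps.  Maximality: an element of the
  -- interval [x , y] comparable with every member of the chain is in it.

  record MaximalChain (x y : Carrier) (n : ℕ) : Set (a ⊔ ℓ₁ ⊔ ℓ₂) where
    field
      chain      : Fin (suc n) → Carrier
      increasing : ∀ {i j} → i Fin.< j → chain i < chain j
      first      : chain zero ≈ x
      last       : chain (fromℕ n) ≈ y
      maximal    : ∀ z → x ≤ z → z ≤ y →
                   (∀ i → z ≤ chain i ⊎ chain i ≤ z) → ∃[ i ] z ≈ chain i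

  IsRank : Carrier → (Carrier → ℕ) → Set (a ⊔ ℓ₁ ⊔ ℓ₂)
  IsRank bot ρ = ∀ x → MaximalChain bot x (ρ x)

  -- Classically only the enumeration carries information.

  record IsFinite : Set (a ⊔ ℓ₁ ⊔ ℓ₂) where
    field
      _≈?_     : Decidable _≈_
      _≤?_     : Decidable _≤_
      elements : List Carrier
      complete : Enumerates.IsEnumeration Eq.setoid elements
      unique   : UniqueSetoid.Unique Eq.setoid elements

  module _ (finite : IsFinite) where

    open IsFinite finite

    Matrix : Set a
    Matrix = Carrier → Carrier → ℤ

    indicator : ∀ {p} {A : Set p} → Dec A → ℤ
    indicator A? = if does A? then 1ℤ else 0ℤ

    ζ δ : Matrix
    ζ x y = indicator (x ≤? y)
    δ x y = indicator (x ≈? y)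

    infixl 7 _⊛_

    _⊛_ : Matrix → Matrix → Matrix
    (f ⊛ g) x y = foldr _+_ 0ℤ (map (λ z → f x z * g z y) elements)

    -- The first field makes μ a matrix indexed by elements up to _≈_.

    record IsMöbius (μ : Matrix) : Set (a ⊔ ℓ₁) where
      field
        cong     : ∀ {x x′ y y′} → x ≈ x′ → y ≈ y′ → μ x y ≡ μ x′ y′
        inverseˡ : ∀ x y → (μ ⊛ ζ) x y ≡ δ x y
        inverseʳ : ∀ x y → (ζ ⊛ μ) x y ≡ δ x y

------------------------------------------------------------------------
-- The diagonal semilattice

AtLeastTwoElements : ∀ {c ℓ} → Group c ℓ → Set (c ⊔ ℓ)
AtLeastTwoElements G = ∃₂ λ x y → ¬ (x ≈ y)
  where open Group G

module DiagonalSemilattice {c ℓ} (G : Group c ℓ) (m : ℕ) where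

  open Group G renaming (setoid to G-setoid)
  open VecEq G-setoid using (_≋_; ≋-setoid)

  Ω : Setoid c ℓ
  Ω = ≋-setoid m

  private module Part = Partitions Ω
  open Poset Part.poset using () renaming (_≈_ to _≐_)
  open Partition

  Q : Fin (suc m) → Partition Ω
  Q zero = record
    { _∼_           = λ g h → ∃[ x ] Lift (c ⊔ ℓ) (∀ i → h i ≈ x ∙ g i)
    ; isEquivalence = record
      { refl  = ε , lift λ i → sym (identityˡ _)
      ; sym   = λ (x , p) → x ⁻¹ , lift λ i →
                  sym (trans (∙-congˡ (lower p i)) (trans (sym (assoc _ _ _))
                    (trans (∙-congʳ (inverseˡ x)) (identityˡ _))))
      ; trans = λ (x , p) (y , q) → y ∙ x , lift λ i →
                  trans (lower q i) (trans (∙-congˡ (lower p i)) (sym (assoc _ _ _)))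
      }
    ; ≈⇒∼           = λ p → ε , lift λ i → trans (sym (p i)) (sym (identityˡ _))
    }
  Q (suc i) = record
    { _∼_           = λ g h → Lift (c ⊔ ℓ) (∀ j → j ≢ i → g j ≈ h j)
    ; isEquivalence = record
      { refl  = lift λ j _ → refl
      ; sym   = λ p → lift λ j j≢i → sym (lower p j j≢i)
      ; trans = λ p q → lift λ j j≢i → trans (lower p j j≢i) (lower q j j≢i)
      }
    ; ≈⇒∼           = λ p → lift λ j _ → p j
    }

  𝒟-Carrier : Set (lsuc (c ⊔ ℓ))
  𝒟-Carrier = Σ[ P ∈ Partition Ω ] ∃[ I ] P ≐ Part.⋁ I Q

  -- Order and equality are those of the underlying partitions.

  𝒟 : Poset (lsuc (c ⊔ ℓ)) (c ⊔ ℓ) (c ⊔ ℓ)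
  𝒟 = On.poset {B = 𝒟-Carrier} Part.poset proj₁

  E : 𝒟-Carrier
  E = Part.E , ⊥
    , (λ p → Part.⋁ ⊥ Q .≈⇒∼ (lower p))
    Interior., Part.⋁-least ⊥ Q {Part.E} (λ i∈⊥ → contradiction i∈⊥ ∉⊥)

  -- Any two points are joined by changing one coordinate at a time.

  private
    patch : Vector Carrier m → Vector Carrier m → List (Fin m) → Vector Carrier m
    patch g h []       = g
    patch g h (i ∷ is) = updateAt (patch g h is) i (const (h i))

    patch-∈ : ∀ g h {i} is → i List.∈ is → patch g h is i ≡ h i
    patch-∈ g h {i} (j ∷ is) i∈ with i ≟ j
    ... | yes ≡.refl = updateAt-updates i (patch g h is)
    ... | no  i≢j    with i∈
    ...   | here i≡j   = contradiction i≡j i≢j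
    ...   | there i∈is = ≡.trans (updateAt-minimal i j (patch g h is) i≢j)
                                 (patch-∈ g h is i∈is)

    module ⋁⊤ = IsEquivalence (Part.⋁ ⊤ Q .isEquivalence)

    ∼-patch : ∀ g h is → Part.⋁ ⊤ Q ._∼_ g (patch g h is)
    ∼-patch g h []       = ⋁⊤.refl
    ∼-patch g h (i ∷ is) = ⋁⊤.trans (∼-patch g h is)
      (Part.⋁-upper ⊤ Q {suc i} ∈⊤
        (lift λ j j≢i → reflexive (≡.sym (updateAt-minimal j i (patch g h is) j≢i))))

  U : 𝒟-Carrier
  U = Part.U , ⊤
    , (λ {g} {h} _ → ⋁⊤.trans (∼-patch g h (allFin m))
        (Part.⋁ ⊤ Q .≈⇒∼ λ i → reflexive (patch-∈ g h (allFin m) (∈-allFin i))))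
    Interior., (λ _ → Unit.tt)

  open Poset 𝒟 public using () renaming (_≤_ to _≼_; _≈_ to _≐_)

{-# OPTIONS --safe #-}
module Submission where

open import Defs
open import Algebra.Bundles using (Group)
import Algebra.Properties.Group as GroupProperties
import Data.Bool.Properties as Bool
open import Data.Bool.Base using (if_then_else_)
open import Data.Fin.Base as Fin using (Fin; zero; suc; toℕ; fromℕ; fromℕ<; inject₁)
open import Data.Fin.Induction using (<-weakInduction)
import Data.Fin.Properties as Fin
open import Data.Fin.Subset using (Subset; inside; outside; ∣_∣; _∈_; _∉_; _⊆_; ⊤; ⊥; ∁; ⁅_⁆; _∪_)
import Data.Fin.Subset as Subset
open import Data.Fin.Subset.Properties as Subset using (_∈?_; _⊆?_)
open import Data.Integer.Base using (ℤ; +_; -1ℤ; 0ℤ; 1ℤ; _+_; _*_; _-_; _^_)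
import Data.Integer.Properties as ℤ
open import Data.Integer.Tactic.RingSolver using (solve-∀)
open import Data.List.Base using (List; []; _∷_; _++_; map; foldr; allFin; deduplicate)
open import Data.List.Properties using (map-∘)
import Data.List.Membership.Propositional as List
open import Data.List.Membership.Propositional.Properties using (∈-map⁺; ∈-map⁻; ∈-++⁺ˡ; ∈-++⁺ʳ; ∈-allFin)
import Data.List.Membership.Setoid as Membership
import Data.List.Membership.Setoid.Properties as Membershipₛ
open import Data.List.Relation.Unary.All as All using (All; []; _∷_)
open import Data.List.Relation.Unary.AllPairs.Core using ([]; _∷_)
open import Data.List.Relation.Unary.Any as Any using (here; there)
import Data.List.Relation.Unary.Unique.DecSetoid.Properties as UniqueDec
open import Data.List.Relation.Unary.Unique.Propositional using (Unique)
import Data.List.Relation.Unary.Unique.Propositional.Properties as Unique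
import Data.List.Relation.Unary.Unique.Setoid as UniqueSetoid
open import Data.Nat.Base as ℕ using (ℕ; zero; suc; _≤_; _<_; _∸_; _⊓_; s≤s)
import Data.Nat.Properties as ℕ
open import Data.Product.Base using (_×_; ∃-syntax; _,_; proj₁; proj₂)
open import Data.Sum.Base using (_⊎_; inj₁; inj₂)
open import Data.Vec.Base using ([]; _∷_; here; there)
open import Data.Vec.Functional using (Vector; updateAt)
open import Data.Vec.Functional.Properties using (updateAt-updates; updateAt-minimal)
open import Data.Vec.Properties using (≡-dec; ∷-injectiveʳ)
open import Function.Base using (_∘_; const)
open import Level using (Level; _⊔_; Lift; lift; lower)
open import Relation.Binary.Bundles using (Setoid; DecSetoid; Poset)
import Relation.Binary.Construct.Interior.Symmetric as Interior
open import Relation.Binary.Definitions using (Decidable)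
import Relation.Binary.Properties.Poset as PosetProperties
open import Relation.Binary.PropositionalEquality.Core as ≡ using (_≡_; _≢_; refl; sym; trans; cong; cong₂; subst)
open import Relation.Binary.PropositionalEquality.Properties as ≡ using (module ≡-Reasoning)
open import Relation.Binary.Structures using (IsEquivalence)
open import Relation.Nullary.Decidable.Core using (Dec; does; yes; no; ¬?; _×-dec_; decidable-stable; map′)
open import Relation.Nullary.Negation.Core using (¬_; contradiction)

-- Let N be the set of indices 0, …, m.  If i and k are distinct indices outside J,
-- then x ↦ xᵢ⁻¹ xₖ (with x₀ = 1) is constant on the parts of every Q_j with j ∈ J,
-- but not on those of Q_i.  Conversely, the join of m of the Q_j is U.  So 𝒟(G,m)
-- is isomorphic to the poset of the subsets C ⊆ N with |C| ≠ m, and cl sends an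
-- index set to the largest one with the same join.  In this poset the rank is
-- min(|C|, m), and both inverse identities reduce to the alternating sum of
-- f(|C|) over C ⊇ S, which is an iterated difference of f: of the affine function
-- m - k, which vanishes, and of the indicator of k < m.

-- Below a closed `T ≢ ⊤` the poset is Boolean, since `T` has fewer than m elements and so contains
-- no coatom. Only the column of `⊤` is new. There the affine function has its zero at m so that the
-- missing coatoms would weigh nothing anyway, and its slope makes μ(⊤, ⊤) equal to 1. A closed
-- `S ≢ ⊤` omits at least two indices, so the alternating sum above it is a difference of order at
-- least two, which kills affine functions. The indicator of k < m selects the closed sets other
-- than `⊤`, whose Boolean contributions have to cancel μ(S, ⊤). Two kinds of freedom remain to be
-- controlled. An element of 𝒟 may carry any index set with the right join, so it has to be made
-- canonical. The rank function, the Möbius function and the enumeration are arbitrary, so the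
-- length of maximal chains and the inverse of ζ have to be shown unique.

private
  variable
    a b : Level
    A : Set a
    B : Set b
    n : ℕ

-- Iverson brackets and finite sums

⟦_⟧ : Dec A → ℤ
⟦ A? ⟧ = if does A? then 1ℤ else 0ℤ

⟦⟧-true : (A? : Dec A) → A → ⟦ A? ⟧ ≡ 1ℤ
⟦⟧-true (yes _) _ = refl
⟦⟧-true (no ¬x) x = contradiction x ¬x

⟦⟧-false : (A? : Dec A) → ¬ A → ⟦ A? ⟧ ≡ 0ℤ
⟦⟧-false (yes x) ¬x = contradiction x ¬x
⟦⟧-false (no _)  _  = refl

⟦⟧-cong : (A? : Dec A) (B? : Dec B) → (A → B) → (B → A) → ⟦ A? ⟧ ≡ ⟦ B? ⟧
⟦⟧-cong (yes x) B? f g = sym (⟦⟧-true B? (f x))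
⟦⟧-cong (no ¬x) B? f g = sym (⟦⟧-false B? (¬x ∘ g))

∑ : List A → (A → ℤ) → ℤ
∑ xs f = foldr _+_ 0ℤ (map f xs)

∑-cong : ∀ (xs : List A) {f g : A → ℤ} → (∀ x → f x ≡ g x) → ∑ xs f ≡ ∑ xs g
∑-cong []       f≗g = refl
∑-cong (x ∷ xs) f≗g = cong₂ _+_ (f≗g x) (∑-cong xs f≗g)

∑-zero : ∀ (xs : List A) {f : A → ℤ} → All (λ x → f x ≡ 0ℤ) xs → ∑ xs f ≡ 0ℤ
∑-zero []       []         = refl
∑-zero (x ∷ xs) (p ∷ ps) = cong₂ _+_ p (∑-zero xs ps)

∑-+ : ∀ (xs : List A) (f g : A → ℤ) → ∑ xs (λ x → f x + g x) ≡ ∑ xs f + ∑ xs g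
∑-+ []       f g = refl
∑-+ (x ∷ xs) f g = trans (cong (λ i → f x + g x + i) (∑-+ xs f g)) (shuffle (f x) (g x) _ _)
  where
  shuffle : ∀ p q r s → p + q + (r + s) ≡ p + r + (q + s)
  shuffle = solve-∀

∑-*ˡ : ∀ (xs : List A) k (f : A → ℤ) → ∑ xs (λ x → k * f x) ≡ k * ∑ xs f
∑-*ˡ []       k f = sym (ℤ.*-zeroʳ k)
∑-*ˡ (x ∷ xs) k f = trans (cong (λ i → k * f x + i) (∑-*ˡ xs k f)) (sym (ℤ.*-distribˡ-+ k (f x) _))

∑-*ʳ : ∀ (xs : List A) (f : A → ℤ) k → ∑ xs (λ x → f x * k) ≡ ∑ xs f * k
∑-*ʳ xs f k = trans (∑-cong xs (λ x → ℤ.*-comm (f x) k)) (trans (∑-*ˡ xs k f) (ℤ.*-comm k _))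

∑-scale : ∀ (xs : List A) k {f g : A → ℤ} → (∀ x → f x ≡ k * g x) → ∑ xs f ≡ k * ∑ xs g
∑-scale xs k {g = g} f≗kg = trans (∑-cong xs f≗kg) (∑-*ˡ xs k g)

∑-swap : ∀ (xs : List A) (ys : List B) (f : A → B → ℤ) →
         ∑ xs (λ x → ∑ ys (f x)) ≡ ∑ ys (λ y → ∑ xs (λ x → f x y))
∑-swap []       ys f = sym (∑-zero ys (All.universal (λ _ → refl) ys))
∑-swap (x ∷ xs) ys f = trans (cong (λ i → ∑ ys (f x) + i) (∑-swap xs ys f)) (sym (∑-+ ys (f x) _))

∑-++ : ∀ (xs ys : List A) (f : A → ℤ) → ∑ (xs ++ ys) f ≡ ∑ xs f + ∑ ys f
∑-++ []       ys f = sym (ℤ.+-identityˡ _)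
∑-++ (x ∷ xs) ys f = trans (cong (λ i → f x + i) (∑-++ xs ys f)) (sym (ℤ.+-assoc (f x) _ _))

∑-map : ∀ (g : A → B) (xs : List A) (f : B → ℤ) → ∑ (map g xs) f ≡ ∑ xs (f ∘ g)
∑-map g xs f = cong (foldr _+_ 0ℤ) (sym (map-∘ xs))

module _ {a ℓ} (S : Setoid a ℓ) (_≈?_ : Decidable (Setoid._≈_ S)) where

  open Setoid S renaming (sym to ≈-sym; trans to ≈-trans)
  open UniqueSetoid S renaming (Unique to Unique≈)
  open Membership S renaming (_∈_ to _∈ₛ_)

  -- Uniqueness up to `≈` leaves a single nonzero term. The entry found is only equivalent to `y`,
  -- which is why `f` has to respect `≈` there.
  ∑-sift : ∀ {xs y} → Unique≈ xs → y ∈ₛ xs → (f : Carrier → ℤ) → (∀ {x} → x ≈ y → f x ≡ f y) →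
           ∑ xs (λ x → ⟦ x ≈? y ⟧ * f x) ≡ f y
  ∑-sift {x ∷ xs} {y} (x∉xs ∷ _) (here y≈x) f f-resp = begin
    ⟦ x ≈? y ⟧ * f x + ∑ xs _ ≡⟨ cong₂ _+_ (cong₂ _*_ (⟦⟧-true (x ≈? y) (≈-sym y≈x)) (f-resp (≈-sym y≈x)))
                                           (∑-zero xs (All.map rest x∉xs)) ⟩
    1ℤ * f y + 0ℤ             ≡⟨ simplify (f y) ⟩
    f y                       ∎
    where
    open ≡-Reasoning
    simplify : ∀ i → 1ℤ * i + 0ℤ ≡ i
    simplify = solve-∀
    rest : ∀ {z} → ¬ (x ≈ z) → ⟦ z ≈? y ⟧ * f z ≡ 0ℤ
    rest {z} x≉z = cong (_* f z) (⟦⟧-false (z ≈? y) λ z≈y → x≉z (≈-sym (≈-trans z≈y y≈x)))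
  ∑-sift {x ∷ xs} {y} (x∉xs ∷ xs!) (there y∈xs) f f-resp = begin
    ⟦ x ≈? y ⟧ * f x + ∑ xs _ ≡⟨ cong₂ _+_ (cong (_* f x) (⟦⟧-false (x ≈? y) x≉y)) (∑-sift xs! y∈xs f f-resp) ⟩
    0ℤ * f x + f y            ≡⟨ ℤ.+-identityˡ (f y) ⟩
    f y                       ∎
    where
    open ≡-Reasoning
    x≉y : ¬ (x ≈ y)
    x≉y x≈y = All.lookupₛ S (λ z≈w x≉z x≈w → x≉z (≈-trans x≈w (≈-sym z≈w))) x∉xs y∈xs x≈y

-- Sums over subsets

subsets : ∀ n → List (Subset n)
subsets zero    = [] ∷ []
subsets (suc n) = map (outside ∷_) (subsets n) ++ map (inside ∷_) (subsets n)

∈-subsets : (C : Subset n) → C List.∈ subsets n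
∈-subsets []            = here refl
∈-subsets (outside ∷ C) = ∈-++⁺ˡ (∈-map⁺ (outside ∷_) (∈-subsets C))
∈-subsets (inside  ∷ C) = ∈-++⁺ʳ _ (∈-map⁺ (inside ∷_) (∈-subsets C))

subsets-unique : ∀ n → Unique (subsets n)
subsets-unique zero    = [] ∷ []
subsets-unique (suc n) = Unique.++⁺
  (Unique.map⁺ ∷-injectiveʳ (subsets-unique n)) (Unique.map⁺ ∷-injectiveʳ (subsets-unique n))
  λ (C∈out , C∈in) → disjoint (∈-map⁻ (outside ∷_) C∈out) (∈-map⁻ (inside ∷_) C∈in)
  where
  disjoint : ∀ {C} → ∃[ D ] D List.∈ subsets n × C ≡ outside ∷ D →
             ¬ (∃[ D ] D List.∈ subsets n × C ≡ inside ∷ D)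
  disjoint (_ , _ , refl) (_ , _ , ())

infix 4 _≟_
_≟_ : Decidable {A = Subset n} _≡_
_≟_ = ≡-dec Bool._≟_

∑-subsets-sift : (D : Subset n) (f : Subset n → ℤ) → ∑ (subsets n) (λ C → ⟦ C ≟ D ⟧ * f C) ≡ f D
∑-subsets-sift {n} D f =
  ∑-sift (≡.setoid (Subset n)) _≟_ (subsets-unique n) (∈-subsets D) f (cong f)

∑-subsets-suc : ∀ n (f : Subset (suc n) → ℤ) →
                ∑ (subsets (suc n)) f ≡ ∑ (subsets n) (f ∘ (outside ∷_)) + ∑ (subsets n) (f ∘ (inside ∷_))
∑-subsets-suc n f = trans (∑-++ (map (outside ∷_) (subsets n)) _ f)
  (cong₂ _+_ (∑-map (outside ∷_) (subsets n) f) (∑-map (inside ∷_) (subsets n) f))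

sign : Subset n → ℤ
sign C = -1ℤ ^ ∣ C ∣

sign-involutive : ∀ k → -1ℤ ^ k * -1ℤ ^ k ≡ 1ℤ
sign-involutive zero    = refl
sign-involutive (suc k) = trans (square (-1ℤ ^ k)) (sign-involutive k)
  where
  square : ∀ i → -1ℤ * i * (-1ℤ * i) ≡ i * i
  square = solve-∀

interval-weight : (S T C : Subset n) → ℤ
interval-weight S T C = ⟦ S ⊆? C ⟧ * (⟦ C ⊆? T ⟧ * sign C)

-- This is the Boolean Möbius inversion. An index in `T` but not in `S` pairs each term with one of
-- opposite sign; an index in `S` but not in `T` leaves no nonzero terms.
∑-interval : (S T : Subset n) → ∑ (subsets n) (interval-weight S T) ≡ ⟦ S ≟ T ⟧ * sign S
∑-interval []      []      = refl
∑-interval {suc n} (outside ∷ S) (outside ∷ T) = begin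
  ∑ (subsets (suc n)) (interval-weight (outside ∷ S) (outside ∷ T))
    ≡⟨ ∑-subsets-suc n _ ⟩
  ∑ (subsets n) (interval-weight S T) + ∑ (subsets n) (λ C → ⟦ S ⊆? C ⟧ * 0ℤ)
    ≡⟨ cong₂ _+_ (∑-interval S T) (∑-zero (subsets n) (All.universal (λ C → ℤ.*-zeroʳ ⟦ S ⊆? C ⟧) _)) ⟩
  ⟦ S ≟ T ⟧ * sign S + 0ℤ
    ≡⟨ ℤ.+-identityʳ (⟦ S ≟ T ⟧ * sign S) ⟩
  ⟦ S ≟ T ⟧ * sign S ∎
  where open ≡-Reasoning
∑-interval {suc n} (outside ∷ S) (inside ∷ T) = begin
  ∑ (subsets (suc n)) (interval-weight (outside ∷ S) (inside ∷ T))
    ≡⟨ ∑-subsets-suc n _ ⟩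
  ∑ (subsets n) (interval-weight S T) + ∑ (subsets n) (λ C → ⟦ S ⊆? C ⟧ * (⟦ C ⊆? T ⟧ * (-1ℤ * sign C)))
    ≡⟨ cong (λ i → ∑ (subsets n) (interval-weight S T) + i)
         (∑-scale (subsets n) -1ℤ (λ C → factor ⟦ S ⊆? C ⟧ ⟦ C ⊆? T ⟧ (sign C))) ⟩
  ∑ (subsets n) (interval-weight S T) + -1ℤ * ∑ (subsets n) (interval-weight S T)
    ≡⟨ cancel (∑ (subsets n) (interval-weight S T)) ⟩
  0ℤ ∎
  where
  open ≡-Reasoning
  factor : ∀ i j k → i * (j * (-1ℤ * k)) ≡ -1ℤ * (i * (j * k))
  factor = solve-∀
  cancel : ∀ i → i + -1ℤ * i ≡ 0ℤ
  cancel = solve-∀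
∑-interval {suc n} (inside ∷ S) (outside ∷ T) = begin
  ∑ (subsets (suc n)) (interval-weight (inside ∷ S) (outside ∷ T))
    ≡⟨ ∑-subsets-suc n _ ⟩
  ∑ (subsets n) (λ _ → 0ℤ) + ∑ (subsets n) (λ C → ⟦ S ⊆? C ⟧ * 0ℤ)
    ≡⟨ cong₂ _+_ (∑-zero (subsets n) (All.universal (λ _ → refl) _))
                 (∑-zero (subsets n) (All.universal (λ C → ℤ.*-zeroʳ ⟦ S ⊆? C ⟧) _)) ⟩
  0ℤ ∎
  where open ≡-Reasoning
∑-interval {suc n} (inside ∷ S) (inside ∷ T) = begin
  ∑ (subsets (suc n)) (interval-weight (inside ∷ S) (inside ∷ T))
    ≡⟨ ∑-subsets-suc n _ ⟩
  ∑ (subsets n) (λ _ → 0ℤ) + ∑ (subsets n) (λ C → ⟦ S ⊆? C ⟧ * (⟦ C ⊆? T ⟧ * (-1ℤ * sign C)))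
    ≡⟨ cong₂ _+_ (∑-zero (subsets n) (All.universal (λ _ → refl) _))
                 (∑-scale (subsets n) -1ℤ (λ C → factor ⟦ S ⊆? C ⟧ ⟦ C ⊆? T ⟧ (sign C))) ⟩
  0ℤ + -1ℤ * ∑ (subsets n) (interval-weight S T)
    ≡⟨ cong (λ i → 0ℤ + -1ℤ * i) (∑-interval S T) ⟩
  0ℤ + -1ℤ * (⟦ S ≟ T ⟧ * sign S)
    ≡⟨ arrange ⟦ S ≟ T ⟧ (sign S) ⟩
  ⟦ S ≟ T ⟧ * (-1ℤ * sign S) ∎
  where
  open ≡-Reasoning
  factor : ∀ i j k → i * (j * (-1ℤ * k)) ≡ -1ℤ * (i * (j * k))
  factor = solve-∀
  arrange : ∀ i j → 0ℤ + -1ℤ * (i * j) ≡ i * (-1ℤ * j)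
  arrange = solve-∀

-- Equal to the sum over j of (-1)^j binomial(d, j) f(k + j). The sign is that of an alternating sum
-- over subsets, so each step is the negative of a forward difference.
Δ : ℕ → (ℕ → ℤ) → ℕ → ℤ
Δ zero    f k = f k
Δ (suc d) f k = Δ d f k - Δ d f (suc k)

Δ-shift : ∀ d f k → Δ d (f ∘ suc) k ≡ Δ d f (suc k)
Δ-shift zero    f k = refl
Δ-shift (suc d) f k = cong₂ _-_ (Δ-shift d f k) (Δ-shift d f (suc k))

superset-weight : (ℕ → ℤ) → (S C : Subset n) → ℤ
superset-weight f S C = ⟦ S ⊆? C ⟧ * (sign C * f ∣ C ∣)

-- Each index outside `S` may be left out or added; adding it flips the sign and moves the argument
-- of `f` by one. Thus every free index contributes one difference.
∑-superset : (S : Subset n) (f : ℕ → ℤ) →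
             ∑ (subsets n) (superset-weight f S) ≡ sign S * Δ (n ∸ ∣ S ∣) f ∣ S ∣

-- The half in which index zero is present, shared by the cases where that index is forced and where
-- it is free.
∑-superset-inside : (S : Subset n) (f : ℕ → ℤ) →
                    ∑ (subsets n) (λ C → ⟦ S ⊆? C ⟧ * (-1ℤ * sign C * f (suc ∣ C ∣))) ≡
                    -1ℤ * (sign S * Δ (n ∸ ∣ S ∣) f (suc ∣ S ∣))
∑-superset-inside {n} S f = begin
  ∑ (subsets n) (λ C → ⟦ S ⊆? C ⟧ * (-1ℤ * sign C * f (suc ∣ C ∣)))
    ≡⟨ ∑-scale (subsets n) -1ℤ (λ C → factor ⟦ S ⊆? C ⟧ (sign C) (f (suc ∣ C ∣))) ⟩
  -1ℤ * ∑ (subsets n) (superset-weight (f ∘ suc) S)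
    ≡⟨ cong (-1ℤ *_) (∑-superset S (f ∘ suc)) ⟩
  -1ℤ * (sign S * Δ (n ∸ ∣ S ∣) (f ∘ suc) ∣ S ∣)
    ≡⟨ cong (λ i → -1ℤ * (sign S * i)) (Δ-shift (n ∸ ∣ S ∣) f ∣ S ∣) ⟩
  -1ℤ * (sign S * Δ (n ∸ ∣ S ∣) f (suc ∣ S ∣)) ∎
  where
  open ≡-Reasoning
  factor : ∀ i j k → i * (-1ℤ * j * k) ≡ -1ℤ * (i * (j * k))
  factor = solve-∀

∑-superset []     f = simplify (f 0)
  where
  simplify : ∀ i → 1ℤ * (1ℤ * i) + 0ℤ ≡ 1ℤ * i
  simplify = solve-∀
∑-superset {suc n} (inside ∷ S) f = begin
  ∑ (subsets (suc n)) (superset-weight f (inside ∷ S))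
    ≡⟨ ∑-subsets-suc n _ ⟩
  ∑ (subsets n) (λ _ → 0ℤ) + ∑ (subsets n) (λ C → ⟦ S ⊆? C ⟧ * (-1ℤ * sign C * f (suc ∣ C ∣)))
    ≡⟨ cong₂ _+_ (∑-zero (subsets n) (All.universal (λ _ → refl) _)) (∑-superset-inside S f) ⟩
  0ℤ + -1ℤ * (sign S * Δ (n ∸ ∣ S ∣) f (suc ∣ S ∣))
    ≡⟨ arrange (sign S) (Δ (n ∸ ∣ S ∣) f (suc ∣ S ∣)) ⟩
  -1ℤ * sign S * Δ (n ∸ ∣ S ∣) f (suc ∣ S ∣) ∎
  where
  open ≡-Reasoning
  arrange : ∀ i j → 0ℤ + -1ℤ * (i * j) ≡ -1ℤ * i * j
  arrange = solve-∀
∑-superset {suc n} (outside ∷ S) f = begin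
  ∑ (subsets (suc n)) (superset-weight f (outside ∷ S))
    ≡⟨ ∑-subsets-suc n _ ⟩
  ∑ (subsets n) (superset-weight f S) + ∑ (subsets n) (λ C → ⟦ S ⊆? C ⟧ * (-1ℤ * sign C * f (suc ∣ C ∣)))
    ≡⟨ cong₂ _+_ (∑-superset S f) (∑-superset-inside S f) ⟩
  (sign S * Δ (n ∸ ∣ S ∣) f ∣ S ∣) + -1ℤ * (sign S * Δ (n ∸ ∣ S ∣) f (suc ∣ S ∣))
    ≡⟨ arrange (sign S) (Δ (n ∸ ∣ S ∣) f ∣ S ∣) (Δ (n ∸ ∣ S ∣) f (suc ∣ S ∣)) ⟩
  sign S * Δ (suc (n ∸ ∣ S ∣)) f ∣ S ∣
    ≡⟨ cong (λ d → sign S * Δ d f ∣ S ∣) (sym (ℕ.+-∸-assoc 1 (Subset.∣p∣≤n S))) ⟩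
  sign S * Δ (suc n ∸ ∣ S ∣) f ∣ S ∣ ∎
  where
  open ≡-Reasoning
  arrange : ∀ s i j → s * i + -1ℤ * (s * j) ≡ s * (i - j)
  arrange = solve-∀

-- The Möbius function of the poset of subsets that are not coatoms

Δ-second-zero : ∀ {f} → (∀ k → Δ 2 f k ≡ 0ℤ) → ∀ d k → Δ (2 ℕ.+ d) f k ≡ 0ℤ
Δ-second-zero Δ²≗0 zero    k = Δ²≗0 k
Δ-second-zero Δ²≗0 (suc d) k = cong₂ _-_ (Δ-second-zero Δ²≗0 d k) (Δ-second-zero Δ²≗0 d (suc k))

module Truncated (m : ℕ) where

  Closed : Subset (suc m) → Set
  Closed C = ∣ C ∣ ≢ m

  closed? : (C : Subset (suc m)) → Dec (Closed C)
  closed? C = ¬? (∣ C ∣ ℕ.≟ m)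

  ∣C∣<m : ∀ {C} → Closed C → C ≢ ⊤ → ∣ C ∣ < m
  ∣C∣<m {C} C-closed C≢⊤ = ℕ.≤∧≢⇒< (ℕ.≤-pred (ℕ.≤∧≢⇒< (Subset.∣p∣≤n C) (C≢⊤ ∘ Subset.∣p∣≡n⇒p≡⊤))) C-closed

  ⊤-closed : Closed ⊤
  ⊤-closed ∣⊤∣≡m = ℕ.1+n≢n (trans (sym (Subset.∣⊤∣≡n (suc m))) ∣⊤∣≡m)

  ⊤⊆⇒≡⊤ : ∀ {C : Subset (suc m)} → ⊤ ⊆ C → C ≡ ⊤
  ⊤⊆⇒≡⊤ {C} ⊤⊆C = Subset.⊆-antisym Subset.⊆⊤ ⊤⊆C

  μ-top : ℕ → ℤ
  μ-top k = -1ℤ ^ m * (+ m - + k)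

  -- μ S ⊤ is 0 if S is a coatom and 1 if S = ⊤, so neither needs a separate clause.

  μ : Subset (suc m) → Subset (suc m) → ℤ
  μ S T = if does (T ≟ ⊤) then sign S * μ-top ∣ S ∣ else ⟦ S ⊆? T ⟧ * (sign S * sign T)

  μ-⊤ : ∀ S {T} → T ≡ ⊤ → μ S T ≡ sign S * μ-top ∣ S ∣
  μ-⊤ S {T} T≡⊤ with T ≟ ⊤
  ... | yes _  = refl
  ... | no T≢⊤ = contradiction T≡⊤ T≢⊤

  μ-≢⊤ : ∀ S {T} → T ≢ ⊤ → μ S T ≡ ⟦ S ⊆? T ⟧ * (sign S * sign T)
  μ-≢⊤ S {T} T≢⊤ with T ≟ ⊤
  ... | yes T≡⊤ = contradiction T≡⊤ T≢⊤
  ... | no _    = refl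

  μ-⊤⊤ : μ ⊤ ⊤ ≡ 1ℤ
  μ-⊤⊤ = begin
    μ ⊤ ⊤                                                     ≡⟨ μ-⊤ ⊤ refl ⟩
    sign (⊤ {suc m}) * μ-top ∣ ⊤ {suc m} ∣                    ≡⟨ cong (λ k → -1ℤ ^ k * μ-top k) (Subset.∣⊤∣≡n (suc m)) ⟩
    -1ℤ * -1ℤ ^ m * (-1ℤ ^ m * (+ m - + suc m))               ≡⟨ cong (λ i → -1ℤ * -1ℤ ^ m * (-1ℤ ^ m * (+ m - i))) (ℤ.pos-+ 1 m) ⟩
    -1ℤ * -1ℤ ^ m * (-1ℤ ^ m * (+ m - (1ℤ + + m)))            ≡⟨ arrange (-1ℤ ^ m) (+ m) ⟩
    -1ℤ ^ m * -1ℤ ^ m                                         ≡⟨ sign-involutive m ⟩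
    1ℤ                                                        ∎
    where
    open ≡-Reasoning
    arrange : ∀ s i → -1ℤ * s * (s * (i - (1ℤ + i))) ≡ s * s
    arrange = solve-∀

  χ : Subset (suc m) → ℤ
  χ C = ⟦ closed? C ⟧

  χ-absorb : ∀ C i → (∣ C ∣ ≡ m → i ≡ 0ℤ) → χ C * i ≡ i
  χ-absorb C i ∣C∣≡m⇒i≡0 = absorb (∣ C ∣ ℕ.≟ m)
    where
    absorb : (∣C∣≟m : Dec (∣ C ∣ ≡ m)) → ⟦ ¬? ∣C∣≟m ⟧ * i ≡ i
    absorb (yes ∣C∣≡m) = sym (∣C∣≡m⇒i≡0 ∣C∣≡m)
    absorb (no _)      = ℤ.*-identityˡ i

  ∑-interval-closed : ∀ {S T} → Closed T → T ≢ ⊤ →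
    ∑ (subsets (suc m)) (λ C → χ C * (⟦ S ⊆? C ⟧ * (⟦ C ⊆? T ⟧ * sign C))) ≡ ⟦ S ≟ T ⟧ * sign S
  ∑-interval-closed {S} {T} T-closed T≢⊤ = trans (∑-cong (subsets (suc m)) drop-χ) (∑-interval S T)
    where
    drop-χ : ∀ C → χ C * (⟦ S ⊆? C ⟧ * (⟦ C ⊆? T ⟧ * sign C)) ≡ ⟦ S ⊆? C ⟧ * (⟦ C ⊆? T ⟧ * sign C)
    drop-χ C = χ-absorb C _ λ ∣C∣≡m → trans
      (cong (λ i → ⟦ S ⊆? C ⟧ * (i * sign C)) (⟦⟧-false (C ⊆? T) λ C⊆T →
        ℕ.<⇒≢ (ℕ.≤-<-trans (Subset.p⊆q⇒∣p∣≤∣q∣ C⊆T) (∣C∣<m T-closed T≢⊤)) ∣C∣≡m))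
      (ℤ.*-zeroʳ ⟦ S ⊆? C ⟧)

  sign-cancel : ∀ S (T : Subset (suc m)) → ⟦ S ≟ T ⟧ * sign S * sign T ≡ ⟦ S ≟ T ⟧
  sign-cancel S T with S ≟ T
  ... | yes refl = trans (cong (_* sign S) (ℤ.*-identityˡ (sign S))) (sign-involutive ∣ S ∣)
  ... | no  _    = refl

  Δ-μ-top : ∀ d k → Δ (2 ℕ.+ d) μ-top k ≡ 0ℤ
  Δ-μ-top = Δ-second-zero λ k → begin
    μ-top k - μ-top (suc k) - (μ-top (suc k) - μ-top (2 ℕ.+ k))
      ≡⟨ cong₂ (λ i j → μ-top k - μ-at i - (μ-at i - μ-at j)) (ℤ.pos-+ 1 k) (ℤ.pos-+ 2 k) ⟩
    μ-at (+ k) - μ-at (+ 1 + + k) - (μ-at (+ 1 + + k) - μ-at (+ 2 + + k))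
      ≡⟨ second-difference (-1ℤ ^ m) (+ m) (+ k) ⟩
    0ℤ ∎
    where
    open ≡-Reasoning
    μ-at : ℤ → ℤ
    μ-at i = -1ℤ ^ m * (+ m - i)
    second-difference : ∀ s i j → s * (i - j) - s * (i - (+ 1 + j)) - (s * (i - (+ 1 + j)) - s * (i - (+ 2 + j))) ≡ 0ℤ
    second-difference = solve-∀

  -- The case split in `μ` is on its second argument, which is fixed here, so one test of `T`
  -- decides the form of all terms.
  ζ⊛μ : ∀ {S T} → Closed S → Closed T →
        ∑ (subsets (suc m)) (λ C → χ C * (⟦ S ⊆? C ⟧ * μ C T)) ≡ ⟦ S ≟ T ⟧
  ζ⊛μ {S} {T} S-closed T-closed with T ≟ ⊤
  ... | no T≢⊤ = begin
    ∑ (subsets (suc m)) (λ C → χ C * (⟦ S ⊆? C ⟧ * (⟦ C ⊆? T ⟧ * (sign C * sign T))))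
      ≡⟨ ∑-scale (subsets (suc m)) (sign T) (λ C → factor (χ C) ⟦ S ⊆? C ⟧ ⟦ C ⊆? T ⟧ (sign C) (sign T)) ⟩
    sign T * ∑ (subsets (suc m)) (λ C → χ C * (⟦ S ⊆? C ⟧ * (⟦ C ⊆? T ⟧ * sign C)))
      ≡⟨ cong (sign T *_) (∑-interval-closed {S} T-closed T≢⊤) ⟩
    sign T * (⟦ S ≟ T ⟧ * sign S)
      ≡⟨ ℤ.*-comm (sign T) _ ⟩
    ⟦ S ≟ T ⟧ * sign S * sign T
      ≡⟨ sign-cancel S T ⟩
    ⟦ S ≟ T ⟧ ∎
    where
    open ≡-Reasoning
    factor : ∀ i j k l r → i * (j * (k * (l * r))) ≡ r * (i * (j * (k * l)))
    factor = solve-∀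
  ... | yes refl = begin
    ∑ (subsets (suc m)) (λ C → χ C * (⟦ S ⊆? C ⟧ * (sign C * μ-top ∣ C ∣)))
      ≡⟨ ∑-cong (subsets (suc m)) drop-χ ⟩
    ∑ (subsets (suc m)) (superset-weight μ-top S)
      ≡⟨ ∑-superset S μ-top ⟩
    sign S * Δ (suc m ∸ ∣ S ∣) μ-top ∣ S ∣
      ≡⟨ evaluate (S ≟ ⊤) ⟩
    ⟦ S ≟ ⊤ ⟧ ∎
    where
    open ≡-Reasoning
    coatom : ∀ s {k} → k ≡ m → s * μ-top k ≡ 0ℤ
    coatom s refl = trans (cong (λ i → s * (-1ℤ ^ m * i)) (ℤ.+-inverseʳ (+ m))) (annihilate s (-1ℤ ^ m))
      where
      annihilate : ∀ i j → i * (j * 0ℤ) ≡ 0ℤ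
      annihilate = solve-∀
    drop-χ : ∀ C → χ C * (⟦ S ⊆? C ⟧ * (sign C * μ-top ∣ C ∣)) ≡ superset-weight μ-top S C
    drop-χ C = χ-absorb C _ λ ∣C∣≡m → trans (cong (⟦ S ⊆? C ⟧ *_) (coatom (sign C) ∣C∣≡m)) (ℤ.*-zeroʳ ⟦ S ⊆? C ⟧)
    evaluate : (S≟⊤ : Dec (S ≡ ⊤)) → sign S * Δ (suc m ∸ ∣ S ∣) μ-top ∣ S ∣ ≡ ⟦ S≟⊤ ⟧
    evaluate (yes refl) = begin
      sign S * Δ (suc m ∸ ∣ S ∣) μ-top ∣ S ∣ ≡⟨ cong (λ d → sign S * Δ d μ-top ∣ S ∣) (trans (cong (suc m ∸_) (Subset.∣⊤∣≡n (suc m))) (ℕ.n∸n≡0 m)) ⟩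
      sign S * μ-top ∣ S ∣                   ≡⟨ μ-⊤ S refl ⟨
      μ ⊤ ⊤                                  ≡⟨ μ-⊤⊤ ⟩
      1ℤ                                     ∎
    -- A closed `S ≢ ⊤` has fewer than m elements, which excludes `zero` here and makes the order
    -- `suc m ∸ ∣ S ∣` of the difference at least two.
    evaluate (no S≢⊤) with m ∸ ∣ S ∣ in eq | ℕ.m<n⇒0<n∸m (∣C∣<m S-closed S≢⊤)
    ... | suc d | _ = begin
      sign S * Δ (suc m ∸ ∣ S ∣) μ-top ∣ S ∣ ≡⟨ cong (λ d → sign S * Δ d μ-top ∣ S ∣) (trans (ℕ.+-∸-assoc 1 (ℕ.<⇒≤ (∣C∣<m S-closed S≢⊤))) (cong suc eq)) ⟩
      sign S * Δ (2 ℕ.+ d) μ-top ∣ S ∣       ≡⟨ cong (sign S *_) (Δ-μ-top d ∣ S ∣) ⟩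
      sign S * 0ℤ                            ≡⟨ ℤ.*-zeroʳ (sign S) ⟩
      0ℤ                                     ∎

  below-m : ℕ → ℤ
  below-m k = ⟦ k ℕ.<? m ⟧

  Δ-below-m-< : ∀ d k → suc (d ℕ.+ k) < m → Δ (suc d) below-m k ≡ 0ℤ
  Δ-below-m-< zero    k k<m = cong₂ _-_ (⟦⟧-true (k ℕ.<? m) (ℕ.<-trans (ℕ.n<1+n k) k<m)) (⟦⟧-true (suc k ℕ.<? m) k<m)
  Δ-below-m-< (suc d) k k<m = cong₂ _-_ (Δ-below-m-< d k (ℕ.<-trans (ℕ.n<1+n _) k<m))
    (Δ-below-m-< d (suc k) (subst (λ i → suc i < m) (sym (ℕ.+-suc d k)) k<m))

  -- Among the values read, only the last one, at m, differs from 1. The constant 1 has difference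
  -- zero, so what is left is minus the coefficient (-1)^(d+1) of that value.
  Δ-below-m-≡ : ∀ d k → suc d ℕ.+ k ≡ m → Δ (suc d) below-m k ≡ -1ℤ ^ d
  Δ-below-m-≡ zero    k eq = cong₂ _-_ (⟦⟧-true (k ℕ.<? m) (ℕ.≤-reflexive eq)) (⟦⟧-false (suc k ℕ.<? m) (ℕ.<-irrefl eq))
  Δ-below-m-≡ (suc d) k eq = begin
    Δ (suc d) below-m k - Δ (suc d) below-m (suc k) ≡⟨ cong₂ _-_ (Δ-below-m-< d k (ℕ.≤-reflexive eq))
                                                         (Δ-below-m-≡ d (suc k) (trans (cong suc (ℕ.+-suc d k)) eq)) ⟩
    0ℤ - -1ℤ ^ d                                    ≡⟨ arrange (-1ℤ ^ d) ⟩
    -1ℤ * -1ℤ ^ d                                   ∎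
    where
    open ≡-Reasoning
    arrange : ∀ i → 0ℤ - i ≡ -1ℤ * i
    arrange = solve-∀

  -- Now the last two values, at m and m + 1, are 0. Their coefficients add up to (-1)^d (d + 1) +
  -- (-1)^(d+1) = (-1)^d d, and the difference is the negative of this. This is where the factor m -
  -- ρ(S) arises.
  Δ-below-m : ∀ d k → d ℕ.+ k ≡ m → Δ (suc d) below-m k ≡ -1ℤ * -1ℤ ^ d * + d
  Δ-below-m zero    k refl = cong₂ _-_ (⟦⟧-false (k ℕ.<? k) (ℕ.<-irrefl refl)) (⟦⟧-false (suc k ℕ.<? k) (ℕ.<-asym (ℕ.n<1+n k)))
  Δ-below-m (suc d) k eq = begin
    Δ (suc d) below-m k - Δ (suc d) below-m (suc k) ≡⟨ cong₂ _-_ (Δ-below-m-≡ d k eq) (Δ-below-m d (suc k) (trans (ℕ.+-suc d k) eq)) ⟩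
    -1ℤ ^ d - -1ℤ * -1ℤ ^ d * + d                   ≡⟨ arrange (-1ℤ ^ d) (+ d) ⟩
    -1ℤ * (-1ℤ * -1ℤ ^ d) * (1ℤ + + d)              ≡⟨ cong (-1ℤ * (-1ℤ * -1ℤ ^ d) *_) (sym (ℤ.pos-+ 1 d)) ⟩
    -1ℤ * (-1ℤ * -1ℤ ^ d) * + suc d                 ∎
    where
    open ≡-Reasoning
    arrange : ∀ s i → s - -1ℤ * s * i ≡ -1ℤ * (-1ℤ * s) * (1ℤ + i)
    arrange = solve-∀

  -- Here the second argument of `μ` is the summation variable, so its case split is resolved term
  -- by term. Below `T ≢ ⊤` every `C` is proper; for `T = ⊤` the term `C = ⊤` is split off, and the
  -- other closed sets are those with `∣ C ∣ < m`.
  μ⊛ζ : ∀ {S T} → Closed S → Closed T →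
        ∑ (subsets (suc m)) (λ C → χ C * (μ S C * ⟦ C ⊆? T ⟧)) ≡ ⟦ S ≟ T ⟧
  μ⊛ζ {S} {T} S-closed T-closed with T ≟ ⊤
  ... | no T≢⊤ = begin
    ∑ (subsets (suc m)) (λ C → χ C * (μ S C * ⟦ C ⊆? T ⟧))
      ≡⟨ ∑-scale (subsets (suc m)) (sign S) weights ⟩
    sign S * ∑ (subsets (suc m)) (λ C → χ C * (⟦ S ⊆? C ⟧ * (⟦ C ⊆? T ⟧ * sign C)))
      ≡⟨ cong (sign S *_) (∑-interval-closed {S} T-closed T≢⊤) ⟩
    sign S * (⟦ S ≟ T ⟧ * sign S)
      ≡⟨ arrange (sign S) ⟦ S ≟ T ⟧ ⟩
    ⟦ S ≟ T ⟧ * (sign S * sign S)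
      ≡⟨ cong (⟦ S ≟ T ⟧ *_) (sign-involutive ∣ S ∣) ⟩
    ⟦ S ≟ T ⟧ * 1ℤ
      ≡⟨ ℤ.*-identityʳ ⟦ S ≟ T ⟧ ⟩
    ⟦ S ≟ T ⟧ ∎
    where
    open ≡-Reasoning
    arrange : ∀ i j → i * (j * i) ≡ j * (i * i)
    arrange = solve-∀
    factor : ∀ i j k l r → i * (k * (r * l) * j) ≡ r * (i * (k * (j * l)))
    factor = solve-∀
    vanish : ∀ i j k l r → i * (j * 0ℤ) ≡ r * (i * (k * (0ℤ * l)))
    vanish = solve-∀
    weights : ∀ C → χ C * (μ S C * ⟦ C ⊆? T ⟧) ≡ sign S * (χ C * (⟦ S ⊆? C ⟧ * (⟦ C ⊆? T ⟧ * sign C)))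
    weights C with C ⊆? T
    ... | no _    = vanish (χ C) (μ S C) ⟦ S ⊆? C ⟧ (sign C) (sign S)
    ... | yes C⊆T = trans (cong (λ i → χ C * (i * 1ℤ)) (μ-≢⊤ S λ { refl → T≢⊤ (⊤⊆⇒≡⊤ C⊆T) }))
                          (factor (χ C) 1ℤ ⟦ S ⊆? C ⟧ (sign C) (sign S))
  ... | yes refl = begin
    ∑ (subsets (suc m)) (λ C → χ C * (μ S C * ⟦ C ⊆? ⊤ ⟧))
      ≡⟨ ∑-cong (subsets (suc m)) split ⟩
    ∑ (subsets (suc m)) (λ C → ⟦ C ≟ ⊤ ⟧ * μ S C + sign S * superset-weight below-m S C)
      ≡⟨ ∑-+ (subsets (suc m)) _ _ ⟩
    ∑ (subsets (suc m)) (λ C → ⟦ C ≟ ⊤ ⟧ * μ S C) + ∑ (subsets (suc m)) (λ C → sign S * superset-weight below-m S C)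
      ≡⟨ cong₂ _+_ (trans (∑-subsets-sift ⊤ (μ S)) (μ-⊤ S refl))
                   (trans (∑-*ˡ (subsets (suc m)) (sign S) _) (cong (sign S *_) (∑-superset S below-m))) ⟩
    sign S * μ-top ∣ S ∣ + sign S * (sign S * Δ (suc m ∸ ∣ S ∣) below-m ∣ S ∣)
      ≡⟨ evaluate (S ≟ ⊤) ⟩
    ⟦ S ≟ ⊤ ⟧ ∎
    where
    open ≡-Reasoning
    top-term : ∀ i b s t → 1ℤ * (i * 1ℤ) ≡ 1ℤ * i + s * (b * (t * 0ℤ))
    top-term = solve-∀
    low-term : ∀ b i s t u → b * (i * (s * t) * 1ℤ) ≡ 0ℤ * u + s * (i * (t * b))
    low-term = solve-∀
    split : ∀ C → χ C * (μ S C * ⟦ C ⊆? ⊤ ⟧) ≡ ⟦ C ≟ ⊤ ⟧ * μ S C + sign S * superset-weight below-m S C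
    split C = by-cases (C ≟ ⊤)
      where
      by-cases : (C≟⊤ : Dec (C ≡ ⊤)) →
                 χ C * (μ S C * ⟦ C ⊆? ⊤ ⟧) ≡ ⟦ C≟⊤ ⟧ * μ S C + sign S * superset-weight below-m S C
      by-cases (yes C≡⊤) = begin
        χ C * (μ S C * ⟦ C ⊆? ⊤ ⟧)
          ≡⟨ cong₂ (λ i j → i * (μ S C * j)) (⟦⟧-true (closed? C) (λ ∣C∣≡m → ⊤-closed (trans (cong ∣_∣ (sym C≡⊤)) ∣C∣≡m)))
                                             (⟦⟧-true (C ⊆? ⊤) Subset.⊆⊤) ⟩
        1ℤ * (μ S C * 1ℤ)
          ≡⟨ top-term (μ S C) ⟦ S ⊆? C ⟧ (sign S) (sign C) ⟩
        1ℤ * μ S C + sign S * (⟦ S ⊆? C ⟧ * (sign C * 0ℤ))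
          ≡⟨ cong (λ i → 1ℤ * μ S C + sign S * (⟦ S ⊆? C ⟧ * (sign C * i))) (sym (⟦⟧-false (∣ C ∣ ℕ.<? m) ∣C∣≮m)) ⟩
        1ℤ * μ S C + sign S * superset-weight below-m S C ∎
        where
        ∣C∣≮m : ¬ (∣ C ∣ < m)
        ∣C∣≮m ∣C∣<m = ℕ.<-asym ∣C∣<m (ℕ.≤-reflexive (sym (trans (cong ∣_∣ C≡⊤) (Subset.∣⊤∣≡n (suc m)))))
      by-cases (no C≢⊤) = begin
        χ C * (μ S C * ⟦ C ⊆? ⊤ ⟧)
          ≡⟨ cong₂ (λ i j → i * (μ S C * j)) (⟦⟧-cong (closed? C) (∣ C ∣ ℕ.<? m) (λ C-closed → ∣C∣<m C-closed C≢⊤) ℕ.<⇒≢)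
                                             (⟦⟧-true (C ⊆? ⊤) Subset.⊆⊤) ⟩
        below-m ∣ C ∣ * (μ S C * 1ℤ)
          ≡⟨ cong (λ i → below-m ∣ C ∣ * (i * 1ℤ)) (μ-≢⊤ S C≢⊤) ⟩
        below-m ∣ C ∣ * (⟦ S ⊆? C ⟧ * (sign S * sign C) * 1ℤ)
          ≡⟨ low-term (below-m ∣ C ∣) ⟦ S ⊆? C ⟧ (sign S) (sign C) (μ S C) ⟩
        0ℤ * μ S C + sign S * superset-weight below-m S C ∎

    evaluate : (S≟⊤ : Dec (S ≡ ⊤)) →
               sign S * μ-top ∣ S ∣ + sign S * (sign S * Δ (suc m ∸ ∣ S ∣) below-m ∣ S ∣) ≡ ⟦ S≟⊤ ⟧
    evaluate (yes refl) = cong₂ _+_ (trans (sym (μ-⊤ S refl)) μ-⊤⊤) (trans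
      (cong (λ i → sign S * (sign S * i)) (trans
        (cong (λ k → Δ (suc m ∸ k) below-m k) (Subset.∣⊤∣≡n (suc m)))
        (trans (cong (λ d → Δ d below-m (suc m)) (ℕ.n∸n≡0 m)) (⟦⟧-false (suc m ℕ.<? m) (ℕ.<-asym (ℕ.n<1+n m))))))
      (annihilate (sign S)))
      where
      annihilate : ∀ s → s * (s * 0ℤ) ≡ 0ℤ
      annihilate = solve-∀
    evaluate (no S≢⊤) = begin
      s * (-1ℤ ^ m * (+ m - + k)) + s * (s * Δ (suc m ∸ k) below-m k)
        ≡⟨ cong₂ (λ i j → s * i + s * (s * j))
             -- With `m` rewritten as `e + k`, the sign `-1ℤ ^ m` factors as `-1ℤ ^ e * s`, and the
             -- two summands become opposite multiples of `e`.
             (trans (cong (λ l → -1ℤ ^ l * (+ l - + k)) (sym e+k≡m)) (cong₂ (λ i j → i * (j - + k)) (ℤ.^-distribˡ-+-* -1ℤ e k) (ℤ.pos-+ e k)))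
             (trans (cong (λ d → Δ d below-m k) (ℕ.+-∸-assoc 1 k≤m)) (Δ-below-m e k e+k≡m)) ⟩
      s * (-1ℤ ^ e * s * (+ e + + k - + k)) + s * (s * (-1ℤ * -1ℤ ^ e * + e))
        ≡⟨ cancel s (-1ℤ ^ e) (+ e) (+ k) ⟩
      0ℤ ∎
      where
      s = sign S
      k = ∣ S ∣
      e = m ∸ k
      k≤m : k ≤ m
      k≤m = ℕ.<⇒≤ (∣C∣<m S-closed S≢⊤)
      e+k≡m : e ℕ.+ k ≡ m
      e+k≡m = ℕ.m∸n+n≡m k≤m
      cancel : ∀ s t i j → s * (t * s * (i + j - j)) + s * (s * (-1ℤ * t * i)) ≡ 0ℤ
      cancel = solve-∀

-- Closure and truncated rank of index sets

∣∪⁅⁆∣ : ∀ {n} (C : Subset n) i → i ∉ C → ∣ C ∪ ⁅ i ⁆ ∣ ≡ suc ∣ C ∣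
∣∪⁅⁆∣ (inside  ∷ C) zero    0∉C = contradiction here 0∉C
∣∪⁅⁆∣ (outside ∷ C) zero    _   = cong (suc ∘ ∣_∣) (Subset.∪-identityʳ C)
∣∪⁅⁆∣ (inside  ∷ C) (suc i) i∉C = cong suc (∣∪⁅⁆∣ C i (i∉C ∘ there))
∣∪⁅⁆∣ (outside ∷ C) (suc i) i∉C = ∣∪⁅⁆∣ C i (i∉C ∘ there)

module Closure (m : ℕ) where

  open Truncated m

  cl : Subset (suc m) → Subset (suc m)
  cl C with ∣ C ∣ ℕ.≟ m
  ... | yes _ = ⊤
  ... | no  _ = C

  cl-fixed : ∀ {C} → Closed C → cl C ≡ C
  cl-fixed {C} C-closed with ∣ C ∣ ℕ.≟ m
  ... | yes ∣C∣≡m = contradiction ∣C∣≡m C-closed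
  ... | no  _     = refl

  cl-small : ∀ {C} → ∣ C ∣ < m → cl C ≡ C
  cl-small = cl-fixed ∘ ℕ.<⇒≢

  cl-large : ∀ {C} → m ≤ ∣ C ∣ → cl C ≡ ⊤
  cl-large {C} m≤∣C∣ with ∣ C ∣ ℕ.≟ m
  ... | yes _     = refl
  ... | no  ∣C∣≢m = Subset.∣p∣≡n⇒p≡⊤ (ℕ.≤-antisym (Subset.∣p∣≤n C) (ℕ.≤∧≢⇒< m≤∣C∣ (≡.≢-sym ∣C∣≢m)))

  cl-closed : ∀ C → Closed (cl C)
  cl-closed C with ∣ C ∣ ℕ.≟ m
  ... | yes _     = ⊤-closed
  ... | no  ∣C∣≢m = ∣C∣≢m

  cl-extensive : ∀ C → C ⊆ cl C
  cl-extensive C with ∣ C ∣ ℕ.≟ m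
  ... | yes _ = Subset.⊆⊤
  ... | no  _ = Subset.⊆-refl

  cl-mono : ∀ {C D} → C ⊆ D → cl C ⊆ cl D
  cl-mono {C} {D} C⊆D with ∣ D ∣ ℕ.<? m
  ... | yes ∣D∣<m = subst (_⊆ cl D) (sym (cl-small (ℕ.≤-<-trans (Subset.p⊆q⇒∣p∣≤∣q∣ C⊆D) ∣D∣<m)))
                      (Subset.⊆-trans C⊆D (cl-extensive D))
  ... | no  ∣D∣≮m = subst (cl C ⊆_) (sym (cl-large {D} (ℕ.≮⇒≥ ∣D∣≮m))) Subset.⊆⊤

  rank : Subset (suc m) → ℕ
  rank C = ∣ C ∣ ⊓ m

  rank-small : ∀ {C} → Closed C → C ≢ ⊤ → rank C ≡ ∣ C ∣
  rank-small C-closed C≢⊤ = ℕ.m≤n⇒m⊓n≡m (ℕ.<⇒≤ (∣C∣<m C-closed C≢⊤))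

  rank-⊤ : rank ⊤ ≡ m
  rank-⊤ = trans (cong (_⊓ m) (Subset.∣⊤∣≡n (suc m))) (ℕ.m≥n⇒m⊓n≡n (ℕ.n≤1+n m))

  rank-mono : ∀ {C D} → C ⊆ D → rank C ≤ rank D
  rank-mono C⊆D = ℕ.⊓-monoˡ-≤ m (Subset.p⊆q⇒∣p∣≤∣q∣ C⊆D)

  private
    ⊆-split : ∀ {C D : Subset (suc m)} → C ⊆ D → D ⊆ C ⊎ (∃[ i ] i ∈ D × i ∉ C)
    ⊆-split {C} {D} C⊆D with Fin.any? (λ i → i ∈? D ×-dec ¬? (i ∈? C))
    ... | yes found = inj₂ found
    ... | no  none  = inj₁ λ {i} i∈D → decidable-stable (i ∈? C) λ i∉C → none (i , i∈D , i∉C)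

    ⊂⇒∣C∣<m : ∀ {C D} → Closed C → ∃[ i ] i ∈ D × i ∉ C → ∣ C ∣ < m
    ⊂⇒∣C∣<m {C} C-closed (i , _ , i∉C) = ∣C∣<m {C} C-closed λ { refl → i∉C Subset.∈⊤ }

  -- Only the cut-off at m could hide an extra element of `D`. But a closed `C` that omits an index
  -- has fewer than m elements, so one more element still raises the rank.
  rank-reflect : ∀ {C D} → Closed C → C ⊆ D → rank D ≤ rank C → D ⊆ C
  rank-reflect {C} {D} C-closed C⊆D rank≤ with ⊆-split C⊆D
  ... | inj₁ D⊆C   = D⊆C
  ... | inj₂ extra = contradiction rank≤ (ℕ.<⇒≱ (ℕ.≤-trans
          (ℕ.≤-reflexive (cong suc (ℕ.m≤n⇒m⊓n≡m (ℕ.<⇒≤ small))))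
          (ℕ.⊓-glb (Subset.p⊂q⇒∣p∣<∣q∣ (C⊆D , extra)) small)))
    where small = ⊂⇒∣C∣<m {C} {D} C-closed extra

  rank-cl : ∀ C → rank (cl C) ≡ rank C
  rank-cl C with ∣ C ∣ ℕ.≟ m
  ... | no  _    = refl
  ... | yes eq = trans rank-⊤ (sym (trans (cong (_⊓ m) eq) (ℕ.⊓-idem m)))

  -- One index of `D` is added to `C`. The result may be a coatom, hence not closed; its rank is
  -- already m, the rank of its closure `⊤`.
  rank-intermediate : ∀ {C D} → Closed C → C ⊆ D → rank C < rank D →
                      ∃[ B ] C ⊆ B × B ⊆ D × rank B ≡ suc (rank C)
  rank-intermediate {C} {D} C-closed C⊆D rank< with ⊆-split C⊆D
  ... | inj₁ D⊆C = contradiction (rank-mono D⊆C) (ℕ.<⇒≱ rank<)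
  ... | inj₂ extra@(i , i∈D , i∉C) = C ∪ ⁅ i ⁆ , Subset.p⊆p∪q ⁅ i ⁆ , union⊆D , (begin
    ∣ C ∪ ⁅ i ⁆ ∣ ⊓ m ≡⟨ cong (_⊓ m) (∣∪⁅⁆∣ C i i∉C) ⟩
    suc ∣ C ∣ ⊓ m     ≡⟨ ℕ.m≤n⇒m⊓n≡m small ⟩
    suc ∣ C ∣         ≡⟨ cong suc (ℕ.m≤n⇒m⊓n≡m (ℕ.<⇒≤ small)) ⟨
    suc (∣ C ∣ ⊓ m)   ∎)
    where
    open ≡-Reasoning
    small = ⊂⇒∣C∣<m {C} {D} C-closed extra
    union⊆D : C ∪ ⁅ i ⁆ ⊆ D
    union⊆D j∈ with Subset.x∈p∪q⁻ C ⁅ i ⁆ j∈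
    ... | inj₁ j∈C = C⊆D j∈C
    ... | inj₂ j∈i = subst (_∈ D) (sym (Subset.x∈⁅y⁆⇒x≡y i j∈i)) i∈D

  -- Provides the second index of the quotient that is constant on the parts of the join over `J`
  -- but not on those of `Q i`.
  two-missing : ∀ {J i} → ∣ J ∣ < m → i ∉ J → ∃[ k ] k ≢ i × k ∉ J
  two-missing {J} {i} ∣J∣<m i∉J with Fin.any? (λ k → ¬? (k Fin.≟ i) ×-dec ¬? (k ∈? J))
  ... | yes found = found
  ... | no  none  = contradiction ∣∁J∣≤1 (ℕ.<⇒≱ 1<∣∁J∣)
    where
    ∁J⊆⁅i⁆ : ∁ J ⊆ ⁅ i ⁆
    ∁J⊆⁅i⁆ {k} k∈∁J = subst (_∈ ⁅ i ⁆)
      (sym (decidable-stable (k Fin.≟ i) λ k≢i → none (k , k≢i , Subset.x∈∁p⇒x∉p k∈∁J))) (Subset.x∈⁅x⁆ i)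
    ∣∁J∣≤1 : ∣ ∁ J ∣ ≤ 1
    ∣∁J∣≤1 = ℕ.≤-trans (Subset.p⊆q⇒∣p∣≤∣q∣ ∁J⊆⁅i⁆) (ℕ.≤-reflexive (Subset.∣⁅x⁆∣≡1 i))
    1<∣∁J∣ : 1 < ∣ ∁ J ∣
    1<∣∁J∣ = subst (1 <_) (sym (trans (Subset.∣∁p∣≡n∸∣p∣ J) (ℕ.+-∸-assoc 1 (ℕ.<⇒≤ ∣J∣<m)))) (s≤s (ℕ.m<n⇒0<n∸m ∣J∣<m))

  at-most-one-missing : ∀ {J} → m ≤ ∣ J ∣ → ∃[ k ] (∀ j → j ≢ k → j ∈ J)
  at-most-one-missing {J} m≤∣J∣ with Subset.nonempty? (∁ J)
  -- No index is missing, so any `k` would serve; `zero` leads to the case of `⋁-large` that needs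
  -- no translation.
  ... | no  empty       = zero , λ j _ → Subset.x∉∁p⇒x∈p λ j∈∁J → empty (j , j∈∁J)
  ... | yes (k , k∈∁J) = k , λ j j≢k → Subset.x∉∁p⇒x∈p λ j∈∁J →
    contradiction ∣∁J∣≤1 (ℕ.<⇒≱ (ℕ.≤-trans (s≤s (nonempty j∈∁J j≢k)) (Subset.x∈p⇒∣p-x∣<∣p∣ k∈∁J)))
    where
    ∣∁J∣≤1 : ∣ ∁ J ∣ ≤ 1
    ∣∁J∣≤1 = subst (_≤ 1) (sym (Subset.∣∁p∣≡n∸∣p∣ J)) (ℕ.m≤n+o⇒m∸n≤o (suc m) ∣ J ∣ (subst (suc m ≤_) (ℕ.+-comm 1 ∣ J ∣) (s≤s m≤∣J∣)))
    nonempty : ∀ {j} → j ∈ ∁ J → j ≢ k → 1 ≤ ∣ ∁ J Subset.- k ∣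
    nonempty {j} j∈∁J j≢k = subst (_≤ ∣ ∁ J Subset.- k ∣) (Subset.∣⁅x⁆∣≡1 j) (Subset.p⊆q⇒∣p∣≤∣q∣ λ x∈ →
      subst (_∈ ∁ J Subset.- k) (sym (Subset.x∈⁅y⁆⇒x≡y j x∈)) (Subset.x∈p∧x≢y⇒x∈p-y j∈∁J j≢k))

  sign-difference : ∀ {k l} → k ≤ l → -1ℤ ^ k * -1ℤ ^ l ≡ -1ℤ ^ (l ∸ k)
  sign-difference {k} {l} k≤l = begin
    -1ℤ ^ k * -1ℤ ^ l                   ≡⟨ cong (λ i → -1ℤ ^ k * -1ℤ ^ i) (ℕ.m∸n+n≡m k≤l) ⟨
    -1ℤ ^ k * -1ℤ ^ (l ∸ k ℕ.+ k)       ≡⟨ cong (-1ℤ ^ k *_) (ℤ.^-distribˡ-+-* -1ℤ (l ∸ k) k) ⟩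
    -1ℤ ^ k * (-1ℤ ^ (l ∸ k) * -1ℤ ^ k) ≡⟨ arrange (-1ℤ ^ k) (-1ℤ ^ (l ∸ k)) ⟩
    -1ℤ ^ (l ∸ k) * (-1ℤ ^ k * -1ℤ ^ k) ≡⟨ cong (-1ℤ ^ (l ∸ k) *_) (sign-involutive k) ⟩
    -1ℤ ^ (l ∸ k) * 1ℤ                  ≡⟨ ℤ.*-identityʳ (-1ℤ ^ (l ∸ k)) ⟩
    -1ℤ ^ (l ∸ k)                       ∎
    where
    open ≡-Reasoning
    arrange : ∀ i j → i * (j * i) ≡ j * (i * i)
    arrange = solve-∀

  μ-rank-≢⊤ : ∀ {S T} → Closed S → Closed T → S ⊆ T → T ≢ ⊤ → μ S T ≡ -1ℤ ^ (rank T ∸ rank S)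
  μ-rank-≢⊤ {S} {T} S-closed T-closed S⊆T T≢⊤ = begin
    μ S T                           ≡⟨ μ-≢⊤ S T≢⊤ ⟩
    ⟦ S ⊆? T ⟧ * (sign S * sign T)  ≡⟨ cong (_* (sign S * sign T)) (⟦⟧-true (S ⊆? T) S⊆T) ⟩
    1ℤ * (sign S * sign T)          ≡⟨ ℤ.*-identityˡ (sign S * sign T) ⟩
    sign S * sign T                 ≡⟨ sign-difference (Subset.p⊆q⇒∣p∣≤∣q∣ S⊆T) ⟩
    -1ℤ ^ (∣ T ∣ ∸ ∣ S ∣)           ≡⟨ cong₂ (λ k l → -1ℤ ^ (k ∸ l)) (rank-small {T} T-closed T≢⊤)
                                          (rank-small {S} S-closed λ { refl → T≢⊤ (⊤⊆⇒≡⊤ S⊆T) }) ⟨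
    -1ℤ ^ (rank T ∸ rank S)         ∎
    where open ≡-Reasoning

  -- Passing from `∣ S ∣` to `rank S` is what excludes `S = ⊤`: the size of `⊤` is m + 1 and its
  -- rank is m, so the formula in terms of the rank would give 0 there.
  μ-rank-⊤ : ∀ {S} → Closed S → S ≢ ⊤ → μ S ⊤ ≡ -1ℤ ^ (m ∸ rank S) * (+ m - + rank S)
  μ-rank-⊤ {S} S-closed S≢⊤ = begin
    μ S ⊤                                          ≡⟨ μ-⊤ S refl ⟩
    sign S * (-1ℤ ^ m * (+ m - + ∣ S ∣))           ≡⟨ ℤ.*-assoc (sign S) (-1ℤ ^ m) (+ m - + ∣ S ∣) ⟨
    sign S * -1ℤ ^ m * (+ m - + ∣ S ∣)             ≡⟨ cong (_* (+ m - + ∣ S ∣)) (sign-difference (ℕ.<⇒≤ (∣C∣<m {S} S-closed S≢⊤))) ⟩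
    -1ℤ ^ (m ∸ ∣ S ∣) * (+ m - + ∣ S ∣)            ≡⟨ cong (λ k → -1ℤ ^ (m ∸ k) * (+ m - + k)) (rank-small {S} S-closed S≢⊤) ⟨
    -1ℤ ^ (m ∸ rank S) * (+ m - + rank S)          ∎
    where open ≡-Reasoning

-- Uniqueness of Möbius functions, and ranks

module _ {a ℓ₁ ℓ₂} (P : Poset a ℓ₁ ℓ₂) (finite : IsFinite P) where

  open Poset P using (_≈_; module Eq)
  open IsFinite finite
  open IsMöbius using (inverseˡ; inverseʳ)

  ∑-elements-sift : ∀ y (f : Poset.Carrier P → ℤ) → (∀ {x} → x ≈ y → f x ≡ f y) →
                    ∑ elements (λ x → ⟦ x ≈? y ⟧ * f x) ≡ f y
  ∑-elements-sift y = ∑-sift Eq.setoid _≈?_ unique (complete y)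

  -- A left inverse and a right inverse of ζ agree: μ = μ(ζν) = (μζ)ν = ν. The fields `cong` enter
  -- because the enumeration meets each element only up to `≈`.
  Möbius-unique : ∀ {μ ν} → IsMöbius P finite μ → IsMöbius P finite ν → ∀ x y → μ x y ≡ ν x y
  Möbius-unique {μ} {ν} isMöbius-μ isMöbius-ν x y = begin
    μ x y
      ≡⟨ ∑-elements-sift y (μ x) (λ x≈y → isMöbius-μ .IsMöbius.cong Eq.refl x≈y) ⟨
    ∑ elements (λ z → δ P finite z y * μ x z)
      ≡⟨ ∑-cong elements expand ⟩
    ∑ elements (λ z → ∑ elements (λ w → μ x z * ζ P finite z w * ν w y))
      ≡⟨ ∑-swap elements elements _ ⟩
    ∑ elements (λ w → ∑ elements (λ z → μ x z * ζ P finite z w * ν w y))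
      ≡⟨ ∑-cong elements collapse ⟩
    ∑ elements (λ w → ⟦ w ≈? x ⟧ * ν w y)
      ≡⟨ ∑-elements-sift x (λ w → ν w y) (λ w≈x → isMöbius-ν .IsMöbius.cong w≈x Eq.refl) ⟩
    ν x y ∎
    where
    open ≡-Reasoning
    expand : ∀ z → δ P finite z y * μ x z ≡ ∑ elements (λ w → μ x z * ζ P finite z w * ν w y)
    expand z = begin
      δ P finite z y * μ x z                                    ≡⟨ ℤ.*-comm _ (μ x z) ⟩
      μ x z * δ P finite z y                                    ≡⟨ cong (μ x z *_) (isMöbius-ν .inverseʳ z y) ⟨
      μ x z * ∑ elements (λ w → ζ P finite z w * ν w y)         ≡⟨ ∑-scale elements (μ x z) (λ w → ℤ.*-assoc (μ x z) _ (ν w y)) ⟨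
      ∑ elements (λ w → μ x z * ζ P finite z w * ν w y)         ∎
    collapse : ∀ w → ∑ elements (λ z → μ x z * ζ P finite z w * ν w y) ≡ ⟦ w ≈? x ⟧ * ν w y
    collapse w = trans (∑-*ʳ elements (λ z → μ x z * ζ P finite z w) (ν w y))
      (cong (_* ν w y) (trans (isMöbius-μ .inverseˡ x w) (⟦⟧-cong (x ≈? w) (w ≈? x) Eq.sym Eq.sym)))

-- Sufficient for `rank x` to be the length of some maximal chain from `bot` to `x` and of every
-- one. The field `reflect` is strict monotonicity in positive form, and `intermediate` says that no
-- rank is skipped.
record Grading {a ℓ₁ ℓ₂} (P : Poset a ℓ₁ ℓ₂) (bot : Poset.Carrier P) (rank : Poset.Carrier P → ℕ) : Set (a ⊔ ℓ₁ ⊔ ℓ₂) where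
  open Poset P renaming (_≤_ to _≼_)
  field
    minimum      : ∀ x → bot ≼ x
    rank-bot     : rank bot ≡ 0
    mono         : ∀ {x y} → x ≼ y → rank x ≤ rank y
    reflect      : ∀ {x y} → x ≼ y → rank y ≤ rank x → y ≼ x
    intermediate : ∀ {x y} → x ≼ y → rank x < rank y → ∃[ z ] x ≼ z × z ≼ y × rank z ≡ suc (rank x)

module _ {a ℓ₁ ℓ₂} {P : Poset a ℓ₁ ℓ₂} {bot : Poset.Carrier P} {rank : Poset.Carrier P → ℕ}
         (grading : Grading P bot rank) where

  open Poset P renaming (_≤_ to _≼_; refl to ≼-refl; trans to ≼-trans; reflexive to ≼-reflexive)
  open PosetProperties P using () renaming (_<_ to _≺_)
  open Grading grading

  rank-cong : ∀ {x y} → x ≈ y → rank x ≡ rank y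
  rank-cong x≈y = ℕ.≤-antisym (mono (≼-reflexive x≈y)) (mono (≼-reflexive (Eq.sym x≈y)))

  ≼∧rank≡⇒≈ : ∀ {x y} → x ≼ y → rank x ≡ rank y → x ≈ y
  ≼∧rank≡⇒≈ x≼y eq = antisym x≼y (reflect x≼y (ℕ.≤-reflexive (sym eq)))

  rank-strict : ∀ {x y} → x ≺ y → rank x < rank y
  rank-strict (x≼y , x≉y) = ℕ.≰⇒> λ rank≥ → x≉y (antisym x≼y (reflect x≼y rank≥))

  private
    module Ascent (x : Carrier) where

      step : (∃[ z ] z ≼ x) → ∃[ z ] z ≼ x
      step (z , z≼x) with rank z ℕ.<? rank x
      ... | yes rank< = let w , _ , w≼x , _ = intermediate z≼x rank< in w , w≼x
      -- A default once the rank of `x` is reached, so that the ascent is a total function on ℕ.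
      ... | no  _     = z , z≼x

      step-≽ : ∀ z → proj₁ z ≼ proj₁ (step z)
      step-≽ (z , z≼x) with rank z ℕ.<? rank x
      ... | yes rank< = let _ , z≼w , _ = intermediate z≼x rank< in z≼w
      ... | no  _     = ≼-refl

      step-rank : ∀ z → rank (proj₁ z) < rank x → rank (proj₁ (step z)) ≡ suc (rank (proj₁ z))
      step-rank (z , z≼x) rank<′ with rank z ℕ.<? rank x
      ... | yes rank< = let _ , _ , _ , eq = intermediate z≼x rank< in eq
      ... | no  rank≮ = contradiction rank<′ rank≮

      ascend : ℕ → ∃[ z ] z ≼ x
      ascend zero    = bot , minimum x
      ascend (suc k) = step (ascend k)

      at : ℕ → Carrier
      at k = proj₁ (ascend k)

      at-rank : ∀ k → k ≤ rank x → rank (at k) ≡ k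
      at-rank zero    _   = rank-bot
      at-rank (suc k) k<r = trans (step-rank (ascend k) (subst (_< rank x) (sym at-k) k<r)) (cong suc at-k)
        where at-k = at-rank k (ℕ.<⇒≤ k<r)

      at-mono : ∀ {i j} → i ℕ.≤′ j → at i ≼ at j
      at-mono                (ℕ.≤′-reflexive refl) = ≼-refl
      at-mono {j = suc j} (ℕ.≤′-step i≤j)       = ≼-trans (at-mono i≤j) (step-≽ (ascend j))

  isRank : IsRank P bot rank
  isRank x = record
    { chain      = at ∘ toℕ
    ; increasing = λ {i} {j} i<j → at-mono (ℕ.≤⇒≤′ (ℕ.<⇒≤ i<j)) , λ eq →
        ℕ.<⇒≢ i<j (trans (sym (at-rank-toℕ i)) (trans (rank-cong eq) (at-rank-toℕ j)))
    ; first      = Eq.refl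
    ; last       = ≼∧rank≡⇒≈ (proj₂ (ascend (toℕ (fromℕ (rank x))))) (trans (at-rank-toℕ (fromℕ (rank x))) (Fin.toℕ-fromℕ (rank x)))
    ; maximal    = λ z _ z≼x comparable →
        -- The chain has a member of every rank up to `rank x`. The one with the rank of `z` is
        -- comparable with `z`, hence equal to it.
        let i = fromℕ< (s≤s (mono z≼x))
        in i , same-rank (comparable i) (trans (sym (Fin.toℕ-fromℕ< (s≤s (mono z≼x)))) (sym (at-rank-toℕ i)))
    }
    where
    open Ascent x
    at-rank-toℕ : (i : Fin (suc (rank x))) → rank (at (toℕ i)) ≡ toℕ i
    at-rank-toℕ i = at-rank (toℕ i) (Fin.toℕ≤pred[n] i)
    same-rank : ∀ {z w} → z ≼ w ⊎ w ≼ z → rank z ≡ rank w → z ≈ w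
    same-rank (inj₁ z≼w) eq = ≼∧rank≡⇒≈ z≼w eq
    same-rank (inj₂ w≼z) eq = Eq.sym (≼∧rank≡⇒≈ w≼z (sym eq))

  -- The rank rises by exactly one at each step. An element one rank above `chain (inject₁ i)` and
  -- below `chain (suc i)` is comparable with the whole chain, so by maximality it is a member;
  -- lying above position `i`, it has at least the rank of `chain (suc i)`.
  MaximalChain-length : ∀ {x n} → MaximalChain P bot x n → n ≡ rank x
  MaximalChain-length {x} {n} maximalChain = begin
    n                      ≡⟨ Fin.toℕ-fromℕ n ⟨
    toℕ (fromℕ n)          ≡⟨ <-weakInduction (λ i → rank (chain i) ≡ toℕ i) (trans (rank-cong first) rank-bot)
                                (λ i eq → trans (rank-suc i) (cong suc (trans eq (Fin.toℕ-inject₁ i)))) (fromℕ n) ⟨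
    rank (chain (fromℕ n)) ≡⟨ rank-cong last ⟩
    rank x                 ∎
    where
    open ≡-Reasoning
    open MaximalChain maximalChain
    chain-mono : ∀ {i j} → i Fin.≤ j → chain i ≼ chain j
    chain-mono {i} {j} i≤j with i Fin.≟ j
    ... | yes refl = ≼-refl
    ... | no  i≢j  = proj₁ (increasing (Fin.≤∧≢⇒< i≤j i≢j))
    rank-suc : (i : Fin n) → rank (chain (suc i)) ≡ suc (rank (chain (inject₁ i)))
    rank-suc i = ℕ.≤-antisym rank-step≤ rank-step<
      where
      rank-step< : rank (chain (inject₁ i)) < rank (chain (suc i))
      rank-step< = rank-strict (increasing (s≤s (ℕ.≤-reflexive (Fin.toℕ-inject₁ i))))
      rank-step≤ : rank (chain (suc i)) ≤ suc (rank (chain (inject₁ i)))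
      rank-step≤ with intermediate (chain-mono {inject₁ i} {suc i} (ℕ.m≤n⇒m≤1+n (ℕ.≤-reflexive (Fin.toℕ-inject₁ i)))) rank-step<
      ... | z , c≼z , z≼c , rank-z = subst (rank (chain (suc i)) ≤_) rank-z (from-member z-member)
        where
        split : ∀ j → j Fin.≤ inject₁ i ⊎ suc i Fin.≤ j
        split j with ℕ.≤-<-connex (toℕ j) (toℕ i)
        ... | inj₁ j≤i = inj₁ (subst (toℕ j ≤_) (sym (Fin.toℕ-inject₁ i)) j≤i)
        ... | inj₂ i<j = inj₂ i<j
        comparable : ∀ j → z ≼ chain j ⊎ chain j ≼ z
        comparable j with split j
        ... | inj₁ j≤i = inj₂ (≼-trans (chain-mono j≤i) c≼z)
        ... | inj₂ i<j = inj₁ (≼-trans z≼c (chain-mono i<j))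
        z-member : ∃[ j ] z ≈ chain j
        z-member = maximal z (minimum z)
          (≼-trans z≼c (≼-trans (chain-mono {suc i} {fromℕ n} (Fin.≤fromℕ (suc i))) (≼-reflexive last))) comparable
        from-member : ∃[ j ] z ≈ chain j → rank (chain (suc i)) ≤ rank z
        from-member (j , z≈c) with split j
        ... | inj₂ i<j = ℕ.≤-trans (mono (chain-mono i<j)) (ℕ.≤-reflexive (rank-cong (Eq.sym z≈c)))
        ... | inj₁ j≤i = contradiction (mono (≼-trans (≼-reflexive z≈c) (chain-mono j≤i)))
                           (ℕ.<⇒≱ (ℕ.≤-reflexive (sym rank-z)))

-- The diagonal semilattice

module Diagonal {c ℓ} (G : Group c ℓ) (m : ℕ) where

  open DiagonalSemilattice G m
  open Partition
  open Partitions Ω using (⋁; ⋁-upper; ⋁-least) renaming (_≼_ to _⊑_)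
  open Truncated m
  open Closure m
  open Group G renaming (refl to ≈-refl; sym to ≈-sym; trans to ≈-trans)
  open GroupProperties G

  -- With an extra coordinate equal to ε, Q zero changes coordinate zero only,
  -- up to left translation.

  coordinate : Vector Carrier m → Fin (suc m) → Carrier
  coordinate g zero    = ε
  coordinate g (suc i) = g i

  quotient : (i k : Fin (suc m)) → Vector Carrier m → Carrier
  quotient i k g = coordinate g i \\ coordinate g k

  Ker : (i k : Fin (suc m)) → Partition Ω
  Ker i k = record
    { _∼_           = λ g h → Lift (c ⊔ ℓ) (quotient i k g ≈ quotient i k h)
    ; isEquivalence = record
      { refl  = lift ≈-refl
      ; sym   = λ p → lift (≈-sym (lower p))
      ; trans = λ p q → lift (≈-trans (lower p) (lower q))
      }
    ; ≈⇒∼           = λ p → lift (\\-cong₂ (coordinate-cong p i) (coordinate-cong p k))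
    }
    where
    coordinate-cong : ∀ {g h} → (∀ i → g i ≈ h i) → ∀ i → coordinate g i ≈ coordinate h i
    coordinate-cong p zero    = ≈-refl
    coordinate-cong p (suc i) = p i

  -- For positive `l` the coordinates `i` and `k` do not move. For `l = zero` both are positive, and
  -- the common left factor cancels in the quotient.
  Q⊑Ker : ∀ {i k} l → l ≢ i → l ≢ k → Q l ⊑ Ker i k
  Q⊑Ker {zero}  {k}     zero l≢i l≢k _ = contradiction refl l≢i
  Q⊑Ker {suc i} {zero}  zero l≢i l≢k _ = contradiction refl l≢k
  Q⊑Ker {suc i} {suc k} zero l≢i l≢k {g} {h} (x , lift p) = lift (≈-sym (begin
    h i ⁻¹ ∙ h k               ≈⟨ \\-cong₂ (p i) (p k) ⟩
    (x ∙ g i) ⁻¹ ∙ (x ∙ g k)   ≈⟨ ∙-congʳ (⁻¹-anti-homo-∙ x (g i)) ⟩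
    g i ⁻¹ ∙ x ⁻¹ ∙ (x ∙ g k)  ≈⟨ assoc (g i ⁻¹) (x ⁻¹) (x ∙ g k) ⟩
    g i ⁻¹ ∙ (x ⁻¹ ∙ (x ∙ g k)) ≈⟨ ∙-congˡ (\\-leftDividesʳ x (g k)) ⟩
    g i ⁻¹ ∙ g k               ∎))
    where open import Relation.Binary.Reasoning.Setoid setoid
  Q⊑Ker {i} {k} (suc l) l≢i l≢k {g} {h} (lift p) = lift (\\-cong₂ (unchanged i l≢i) (unchanged k l≢k))
    where
    unchanged : ∀ j → suc l ≢ j → coordinate g j ≈ coordinate h j
    unchanged zero    _   = ≈-refl
    unchanged (suc j) l≢j = p j λ { refl → l≢j refl }

  -- A move along Q i can take the quotient of the coordinates i and k from any
  -- element to any other, so invariance under Q i makes G trivial.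

  Q⊑Ker⇒≈ : ∀ {i k} → k ≢ i → Q i ⊑ Ker i k → ∀ u v → u ≈ v
  Q⊑Ker⇒≈ {zero}  {zero}  k≢i _     u v = contradiction refl k≢i
  Q⊑Ker⇒≈ {zero}  {suc k} k≢i Q⊑Ker u v =
    -- Left translation by `v // u` takes the constant vector `u` to the constant vector `v`, and
    -- the quotient from coordinate zero reads off the constant, up to the factor `ε ⁻¹`.
    ∙-cancelˡ (ε ⁻¹) u v (lower (Q⊑Ker {const u} {const v} (v // u , lift λ _ → ≈-sym (//-rightDividesˡ u v))))
  Q⊑Ker⇒≈ {suc i} {k}     k≢i Q⊑Ker u v = ⁻¹-injective (begin
    u ⁻¹                       ≈⟨ quotient-single u ⟨
    quotient (suc i) k (single u) ≈⟨ lower (Q⊑Ker {single u} {single v} (lift λ j j≢i →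
         reflexive (≡.trans (updateAt-minimal j i _ j≢i) (≡.sym (updateAt-minimal j i _ j≢i))))) ⟩
    quotient (suc i) k (single v) ≈⟨ quotient-single v ⟩
    v ⁻¹                       ∎)
    where
    open import Relation.Binary.Reasoning.Setoid setoid
    -- All coordinates other than `suc i` are `ε`, including the extra one, so `k = zero` and `k`
    -- positive are treated alike.
    single : Carrier → Vector Carrier m
    single u = updateAt (const ε) i (const u)
    coordinate-single : ∀ u k → k ≢ suc i → coordinate (single u) k ≡ ε
    coordinate-single u zero    _   = refl
    coordinate-single u (suc k) k≢i = updateAt-minimal k i _ (k≢i ∘ cong suc)
    quotient-single : ∀ u → quotient (suc i) k (single u) ≈ u ⁻¹
    quotient-single u = ≈-trans
      (\\-cong₂ (reflexive (updateAt-updates i {const u} (const ε))) (reflexive (coordinate-single u k k≢i)))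
      (identityʳ (u ⁻¹))

  module _ {J : Subset (suc m)} where

    private module ⋁J = IsEquivalence (⋁ J Q .isEquivalence)

    -- The list holds the coordinates that may still be wrong. Each is corrected by a move along its
    -- own `Q`, or already agrees with the target.
    change-coordinates : ∀ is g h → (∀ i → i List.∉ is → g i ≈ h i) → (∀ i → suc i ∈ J ⊎ g i ≈ h i) →
                         ⋁ J Q ._∼_ g h
    change-coordinates []       g h agree _ = ⋁ J Q .≈⇒∼ λ i → agree i λ ()
    change-coordinates (i ∷ is) g h agree allowed =
      ⋁J.trans (first (allowed i)) (change-coordinates is g′ h agree′ allowed′)
      where
      g′ : Vector Carrier m
      g′ = updateAt g i (const (h i))
      g′-elsewhere : ∀ {j} → j ≢ i → g′ j ≈ g j
      g′-elsewhere {j} j≢i = reflexive (updateAt-minimal j i g j≢i)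
      g′-here : g′ i ≈ h i
      g′-here = reflexive (updateAt-updates i g)
      first : suc i ∈ J ⊎ g i ≈ h i → ⋁ J Q ._∼_ g g′
      first (inj₁ i∈J) = ⋁-upper J Q i∈J (lift λ j j≢i → ≈-sym (g′-elsewhere j≢i))
      first (inj₂ eq)  = ⋁ J Q .≈⇒∼ unchanged
        where
        unchanged : ∀ j → g j ≈ g′ j
        unchanged j with j Fin.≟ i
        ... | yes refl = ≈-trans eq (≈-sym g′-here)
        ... | no  j≢i  = ≈-sym (g′-elsewhere j≢i)
      agree′ : ∀ j → j List.∉ is → g′ j ≈ h j
      agree′ j j∉is with j Fin.≟ i
      ... | yes refl = g′-here
      ... | no  j≢i  = ≈-trans (g′-elsewhere j≢i) (agree j λ { (here j≡i) → j≢i j≡i ; (there j∈is) → j∉is j∈is })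
      allowed′ : ∀ j → suc j ∈ J ⊎ g′ j ≈ h j
      allowed′ j with j Fin.≟ i | allowed j
      ... | yes refl | _         = inj₂ g′-here
      ... | no  j≢i  | inj₁ j∈J  = inj₁ j∈J
      ... | no  j≢i  | inj₂ gj≈h = inj₂ (≈-trans (g′-elsewhere j≢i) gj≈h)

    change-all-coordinates : ∀ g h → (∀ i → suc i ∈ J ⊎ g i ≈ h i) → ⋁ J Q ._∼_ g h
    change-all-coordinates g h = change-coordinates (allFin m) g h λ i i∉ → contradiction (∈-allFin i) i∉

    -- If a positive index `suc k` is missing, then `Q zero` is available: a left translation
    -- corrects coordinate `k`, and the other coordinates, which it disturbs, can be changed freely
    -- afterwards.
    ⋁-large : m ≤ ∣ J ∣ → ∀ g h → ⋁ J Q ._∼_ g h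
    ⋁-large m≤∣J∣ g h with at-most-one-missing {J} m≤∣J∣
    ... | zero  , present = change-all-coordinates g h λ i → inj₁ (present (suc i) λ ())
    ... | suc k , present = ⋁J.trans (⋁-upper J Q (present zero λ ()) (h k // g k , lift λ _ → ≈-refl))
      (change-all-coordinates (λ i → (h k // g k) ∙ g i) h allowed)
      where
      allowed : ∀ i → suc i ∈ J ⊎ (h k // g k) ∙ g i ≈ h i
      allowed i with i Fin.≟ k
      ... | yes refl = inj₂ (//-rightDividesˡ (g k) (h k))
      ... | no  i≢k  = inj₁ (present (suc i) (i≢k ∘ Fin.suc-injective))

  cl⊆⇒⋁⊑ : ∀ {I J} → cl I ⊆ cl J → ⋁ I Q ⊑ ⋁ J Q
  cl⊆⇒⋁⊑ {I} {J} clI⊆clJ with ∣ J ∣ ℕ.<? m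
  ... | yes ∣J∣<m = ⋁-least I Q {⋁ J Q} λ i∈I →
          ⋁-upper J Q (subst (_ ∈_) (cl-small ∣J∣<m) (clI⊆clJ (cl-extensive I i∈I)))
  ... | no  ∣J∣≮m = λ _ → ⋁-large {J} (ℕ.≮⇒≥ ∣J∣≮m) _ _

  -- Identification of 𝒟 with the poset of closed index sets

  module WithTwo (two : AtLeastTwoElements G) where

    -- Nontriviality of the group enters here: over a trivial group all the joins coincide. For an
    -- index `i` of `I` outside `J`, refinement would make the quotient in `Ker i k` invariant under
    -- `Q i`.
    ⋁⊑⇒cl⊆ : ∀ {I J} → ⋁ I Q ⊑ ⋁ J Q → cl I ⊆ cl J
    ⋁⊑⇒cl⊆ {I} {J} ⋁I⊑⋁J with ∣ J ∣ ℕ.<? m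
    ... | no  ∣J∣≮m = subst (cl I ⊆_) (sym (cl-large {J} (ℕ.≮⇒≥ ∣J∣≮m))) Subset.⊆⊤
    ... | yes ∣J∣<m = cl-mono I⊆J
      where
      I⊆J : I ⊆ J
      I⊆J {i} i∈I with i ∈? J
      ... | yes i∈J = i∈J
      ... | no  i∉J = let u , v , u≉v = two
                          k , k≢i , k∉J = two-missing ∣J∣<m i∉J
                          ⋁J⊑Ker : ⋁ J Q ⊑ Ker i k
                          ⋁J⊑Ker = ⋁-least J Q {Ker i k} λ {l} l∈J → Q⊑Ker {i} {k} l (λ { refl → i∉J l∈J }) (λ { refl → k∉J l∈J })
                      in contradiction (Q⊑Ker⇒≈ k≢i (λ p → ⋁J⊑Ker (⋁I⊑⋁J (⋁-upper I Q i∈I p))) u v) u≉v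

    -- The index set stored in an element is not determined by its partition, but the closure of
    -- that set is, by `≐⇒≡`.
    index : 𝒟-Carrier → Subset (suc m)
    index (_ , I , _) = cl I

    index-closed : ∀ x → Closed (index x)
    index-closed (_ , I , _) = cl-closed I

    element : Subset (suc m) → 𝒟-Carrier
    element C = ⋁ C Q , C , (λ p → p) Interior., (λ p → p)

    ≼⇒⊆ : ∀ {x y} → x ≼ y → index x ⊆ index y
    ≼⇒⊆ {_ , I , P≐⋁I} {_ , J , R≐⋁J} x≼y =
      ⋁⊑⇒cl⊆ {I} {J} λ p → Interior.lhs≤rhs R≐⋁J (x≼y (Interior.rhs≤lhs P≐⋁I p))

    ⊆⇒≼ : ∀ {x y} → index x ⊆ index y → x ≼ y
    ⊆⇒≼ {_ , I , P≐⋁I} {_ , J , R≐⋁J} cl⊆ p =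
      Interior.rhs≤lhs R≐⋁J (cl⊆⇒⋁⊑ {I} {J} cl⊆ (Interior.lhs≤rhs P≐⋁I p))

    ≐⇒≡ : ∀ {x y} → x ≐ y → index x ≡ index y
    ≐⇒≡ {x} {y} (x≼y Interior., y≼x) = Subset.⊆-antisym (≼⇒⊆ {x} {y} x≼y) (≼⇒⊆ {y} {x} y≼x)

    ≡⇒≐ : ∀ {x y} → index x ≡ index y → x ≐ y
    ≡⇒≐ {x} {y} eq = ⊆⇒≼ {x} {y} (Subset.⊆-reflexive eq) Interior., ⊆⇒≼ {y} {x} (Subset.⊆-reflexive (sym eq))

    index-U : index U ≡ ⊤
    index-U = cl-fixed ⊤-closed

    grading : Grading 𝒟 E (rank ∘ index)
    grading = record
      { minimum      = λ x → ⊆⇒≼ {E} {x} (cl-mono {⊥} {proj₁ (proj₂ x)} (Subset.⊆-min _))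
      ; rank-bot     = trans (rank-cl ⊥) (cong (_⊓ m) (Subset.∣⊥∣≡0 (suc m)))
      ; mono         = λ {x} {y} x≼y → rank-mono (≼⇒⊆ {x} {y} x≼y)
      ; reflect      = λ {x} {y} x≼y rank≤ →
          ⊆⇒≼ {y} {x} (rank-reflect (index-closed x) (≼⇒⊆ {x} {y} x≼y) rank≤)
      ; intermediate = λ {x} {y} x≼y rank< →
          let B , x⊆B , B⊆y , rank-B = rank-intermediate (index-closed x) (≼⇒⊆ {x} {y} x≼y) rank<
          in element B
           , ⊆⇒≼ {x} {element B} (Subset.⊆-trans x⊆B (cl-extensive B))
           , ⊆⇒≼ {element B} {y} (subst (cl B ⊆_) (cl-fixed (index-closed y)) (cl-mono B⊆y))
           , trans (rank-cl B) rank-B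
      }

    private
      module 𝒟 = Poset 𝒟

    _≐?_ : Decidable _≐_
    x ≐? y = map′ (≡⇒≐ {x} {y}) (≐⇒≡ {x} {y}) (index x ≟ index y)

    decSetoid : DecSetoid _ _
    decSetoid = record
      { isDecEquivalence = record { isEquivalence = 𝒟.isEquivalence ; _≟_ = _≐?_ } }

    isFinite : IsFinite 𝒟
    isFinite = record
      { _≈?_     = _≐?_
      ; _≤?_     = λ x y → map′ (⊆⇒≼ {x} {y}) (≼⇒⊆ {x} {y}) (index x ⊆? index y)
      -- Coatoms and `⊤` all have the join U, so the list of all joins contains repetitions.
      ; elements = deduplicate _≐?_ (map element (subsets (suc m)))
      ; complete = λ x → Membershipₛ.∈-deduplicate⁺ 𝒟.Eq.setoid _≐?_
          (λ {x} {y} {z} z≐y x≐y → 𝒟.Eq.trans {x} {y} {z} x≐y (𝒟.Eq.sym {z} {y} z≐y))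
          {map element (subsets (suc m))} {x}
          (Any.map (λ element≡y → subst (x ≐_) element≡y (≡⇒≐ {x} {element (index x)} (sym (cl-fixed (index-closed x)))))
            (∈-map⁺ element (∈-subsets (index x))))
      ; unique   = UniqueDec.deduplicate-! decSetoid (map element (subsets (suc m)))
      }

    -- Transport of the Möbius function to 𝒟

    module _ (finite : IsFinite 𝒟) where

      open IsFinite finite

      -- After exchanging the sums, the coefficient of `f C` counts the listed elements with index
      -- `C`: one if `C` is closed, and none otherwise. This holds for every enumeration.
      ∑-elements : (f : Subset (suc m) → ℤ) →
                   ∑ elements (f ∘ index) ≡ ∑ (subsets (suc m)) (λ C → χ C * f C)
      ∑-elements f = begin
        ∑ elements (f ∘ index)
          ≡⟨ ∑-cong elements (λ x → ∑-subsets-sift (index x) f) ⟨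
        ∑ elements (λ x → ∑ (subsets (suc m)) (λ C → ⟦ C ≟ index x ⟧ * f C))
          ≡⟨ ∑-swap elements (subsets (suc m)) _ ⟩
        ∑ (subsets (suc m)) (λ C → ∑ elements (λ x → ⟦ C ≟ index x ⟧ * f C))
          ≡⟨ ∑-cong (subsets (suc m)) (λ C → trans (∑-*ʳ elements _ (f C)) (cong (_* f C) (count C))) ⟩
        ∑ (subsets (suc m)) (λ C → χ C * f C) ∎
        where
        open ≡-Reasoning
        count-closed : ∀ {C} → Closed C → ∑ elements (λ x → ⟦ C ≟ index x ⟧) ≡ 1ℤ
        count-closed {C} C-closed = begin
          ∑ elements (λ x → ⟦ C ≟ index x ⟧)
            ≡⟨ ∑-cong elements (λ x → trans (⟦⟧-cong (C ≟ index x) (x ≈? element C)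
                 (λ C≡x → ≡⇒≐ {x} {element C} (trans (sym C≡x) (sym (cl-fixed C-closed))))
                 (λ x≐C → trans (sym (cl-fixed C-closed)) (sym (≐⇒≡ {x} {element C} x≐C))))
                 (sym (ℤ.*-identityʳ _))) ⟩
          ∑ elements (λ x → ⟦ x ≈? element C ⟧ * 1ℤ)
            ≡⟨ ∑-elements-sift 𝒟 finite (element C) (const 1ℤ) (λ _ → refl) ⟩
          1ℤ ∎
        count : ∀ C → ∑ elements (λ x → ⟦ C ≟ index x ⟧) ≡ χ C
        count C = by-cases (closed? C)
          where
          by-cases : (C-closed? : Dec (Closed C)) → ∑ elements (λ x → ⟦ C ≟ index x ⟧) ≡ ⟦ C-closed? ⟧
          by-cases (yes C-closed) = count-closed {C} C-closed
          by-cases (no C-open)    = ∑-zero elements (All.universal (λ x →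
            ⟦⟧-false (C ≟ index x) λ { refl → C-open (index-closed x) }) elements)

      isMöbius : IsMöbius 𝒟 finite (λ x y → μ (index x) (index y))
      isMöbius = record
        { cong     = λ {x} {x′} {y} {y′} x≐x′ y≐y′ → cong₂ μ (≐⇒≡ {x} {x′} x≐x′) (≐⇒≡ {y} {y′} y≐y′)
        ; inverseˡ = λ x y → begin
            ∑ elements (λ z → μ (index x) (index z) * ⟦ z ≤? y ⟧)
              ≡⟨ ∑-cong elements (λ z → cong (μ (index x) (index z) *_) (ζ-index z y)) ⟩
            ∑ elements (λ z → μ (index x) (index z) * ⟦ index z ⊆? index y ⟧)
              ≡⟨ ∑-elements (λ C → μ (index x) C * ⟦ C ⊆? index y ⟧) ⟩
            ∑ (subsets (suc m)) (λ C → χ C * (μ (index x) C * ⟦ C ⊆? index y ⟧))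
              ≡⟨ μ⊛ζ {index x} {index y} (index-closed x) (index-closed y) ⟩
            ⟦ index x ≟ index y ⟧
              ≡⟨ δ-index x y ⟨
            ⟦ x ≈? y ⟧ ∎
        ; inverseʳ = λ x y → begin
            ∑ elements (λ z → ⟦ x ≤? z ⟧ * μ (index z) (index y))
              ≡⟨ ∑-cong elements (λ z → cong (_* μ (index z) (index y)) (ζ-index x z)) ⟩
            ∑ elements (λ z → ⟦ index x ⊆? index z ⟧ * μ (index z) (index y))
              ≡⟨ ∑-elements (λ C → ⟦ index x ⊆? C ⟧ * μ C (index y)) ⟩
            ∑ (subsets (suc m)) (λ C → χ C * (⟦ index x ⊆? C ⟧ * μ C (index y)))
              ≡⟨ ζ⊛μ {index x} {index y} (index-closed x) (index-closed y) ⟩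
            ⟦ index x ≟ index y ⟧
              ≡⟨ δ-index x y ⟨
            ⟦ x ≈? y ⟧ ∎
        }
        where
        open ≡-Reasoning
        -- The decision procedures come from an arbitrary `finite`, so brackets are compared through
        -- the equivalence of the propositions decided.
        ζ-index : ∀ x y → ⟦ x ≤? y ⟧ ≡ ⟦ index x ⊆? index y ⟧
        ζ-index x y = ⟦⟧-cong (x ≤? y) (index x ⊆? index y) (≼⇒⊆ {x} {y}) (⊆⇒≼ {x} {y})
        δ-index : ∀ x y → ⟦ x ≈? y ⟧ ≡ ⟦ index x ≟ index y ⟧
        δ-index x y = ⟦⟧-cong (x ≈? y) (index x ≟ index y) (≐⇒≡ {x} {y}) (≡⇒≐ {x} {y})

theorem4p1 :
  ∀ {c ℓ} (m : ℕ) → 2 ≤ m → (G : Group c ℓ) → AtLeastTwoElements G →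
  let open DiagonalSemilattice G m in
  -- 𝒟 is finite, and its rank and Möbius functions exist
  IsFinite 𝒟
  × (∃[ ρ ] IsRank 𝒟 E ρ)
  × (∀ finite → ∃[ μ ] IsMöbius 𝒟 finite μ)
  -- ρ(U) = m, and the values of the Möbius function
  × (∀ finite ρ μ → IsRank 𝒟 E ρ → IsMöbius 𝒟 finite μ →
      ρ U ≡ m
      × (∀ S T → S ≼ T →
          (¬ (T ≐ U) → μ S T ≡ -1ℤ ^ (ρ T ∸ ρ S))
          -- S = T = U is separate: there m - ρ(S) = 0, but μ(U,U) = 1
          × (T ≐ U → ¬ (S ≐ U) →
              (μ S T ≡ -1ℤ ^ (ρ U ∸ ρ S) * (+ ρ U - + ρ S))
              × (μ S T ≡ -1ℤ ^ (m ∸ ρ S) * (+ m - + ρ S)))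
          × (T ≐ U → S ≐ U → μ S T ≡ 1ℤ)))
theorem4p1 {c} {ℓ} m _ G two =
    isFinite , (rank ∘ index , isRank grading)
  , (λ finite → _ , isMöbius finite)
  , λ finite ρ ν ρ-isRank ν-isMöbius →
      -- Uniqueness replaces the given rank and Möbius functions by the explicit ones, whose values
      -- depend only on the index sets.
      let ρ-index : ∀ x → ρ x ≡ rank (index x)
          ρ-index x = MaximalChain-length grading (ρ-isRank x)
          ρ-U : ρ U ≡ m
          ρ-U = trans (ρ-index U) (trans (cong rank index-U) rank-⊤)
          ν-index : ∀ x y → ν x y ≡ μ (index x) (index y)
          ν-index = Möbius-unique 𝒟 finite ν-isMöbius (isMöbius finite)
          ≢⊤ : ∀ x → ¬ (x ≐ U) → index x ≢ ⊤
          ≢⊤ x x≭U eq = x≭U (≡⇒≐ {x} {U} (trans eq (sym index-U)))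
          ≡⊤ : ∀ x → x ≐ U → index x ≡ ⊤
          ≡⊤ x x≐U = trans (≐⇒≡ {x} {U} x≐U) index-U
          top : ∀ S T → T ≐ U → ¬ (S ≐ U) → ν S T ≡ -1ℤ ^ (m ∸ ρ S) * (+ m - + ρ S)
          top S T T≐U S≭U = trans (ν-index S T) (trans (cong (μ (index S)) (≡⊤ T T≐U))
            (trans (μ-rank-⊤ (index-closed S) (≢⊤ S S≭U))
                   (cong (λ k → -1ℤ ^ (m ∸ k) * (+ m - + k)) (sym (ρ-index S)))))
      in ρ-U , λ S T S≼T →
           (λ T≭U → trans (ν-index S T) (trans
             (μ-rank-≢⊤ (index-closed S) (index-closed T) (≼⇒⊆ {S} {T} S≼T) (≢⊤ T T≭U))
             (cong₂ (λ k l → -1ℤ ^ (k ∸ l)) (sym (ρ-index T)) (sym (ρ-index S)))))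
         , (λ T≐U S≭U →
               trans (top S T T≐U S≭U) (cong (λ k → -1ℤ ^ (k ∸ ρ S) * (+ k - + ρ S)) (sym ρ-U))
             , top S T T≐U S≭U)
         , (λ T≐U S≐U → trans (ν-index S T) (trans (cong₂ μ (≡⊤ S S≐U) (≡⊤ T T≐U)) μ-⊤⊤))
  where
  open DiagonalSemilattice G m using (𝒟; E; U; _≼_; _≐_)
  open Truncated m
  open Closure m
  open Diagonal G m
  open WithTwo two
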